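{- Let $T\in\mathcal F$ be a trigraph with no balanced skew-partition, and let $(A_1,B_1,C_1,A_2,B_2,C_2)$ be a split of a $2$-join $(X_1,X_2)$ of $T$. Then: (i) $(X_1,X_2)$ is a proper $2$-join; and for $i=1,2$: (ii) every vertex of $X_i$ has a neighbor in $X_i$; (iii) every vertex of $A_i$ has an antineighbor in $B_i$; (iv) every vertex of $B_i$ has an antineighbor in $A_i$; (v) every vertex of $A_i$ has a neighbor in $C_i\cup B_i$; (vi) every vertex of $B_i$ has a neighbor in $C_i\cup A_i$; (vii) if $C_i=\emptyset$ then $|A_i|\ge2$ and $|B_i|\ge2$; (viii) $|X_i|\ge4$.
   Context: A trigraph $T$ consists of a finite vertex set $V(T)$ and a map $\theta:\binom{V(T)}{2}\to\{ -1,0,1\}$. Distinct $u,v$ are strongly adjacent if $\theta(uv)=1$, strongly antiadjacent if $\theta(uv)=-1$, and form a switchable pair if $\theta(uv)=0$; adjacent (so $u$ is a neighbor of $v$) if $\theta(uv)\in\{0,1\}$, antiadjacent (antineighbor) if $\theta(uv)\in\{ -1,0\}$. The complement $\overline T$ has adjacency $-\theta$; $T|X$ is the induced trigraph on $X$. Strongly complete/anticomplete: strongly adjacent/antiadjacent to every vertex of the set. The full realization of $T$ is the graph on $V(T)$ whose edges are adjacent pairs. $X$ is connected if the full realization of $T|X$ is connected, anticonnected if the complement of the graph on $X$ of strongly adjacent pairs is connected; components are maximal connected subsets. Paths: sequences $p_1,\dots,p_k$ of distinct vertices, consecutive ones adjacent and non-consecutive ones antiadjacent (length $k-1$, interior the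 inner vertices). Holes: $h_1,\dots,h_k$, $k\ge4$, with $h_i,h_j$ adjacent iff $|i-j|\in\{1,k-1\}$, antiadjacent otherwise (length $k$). Antipaths/antiholes: induced subtrigraphs whose complement is a path/hole of $\overline T$. Berge: no odd hole, no odd antihole. A skew-partition is a partition $(A,B)$ of $V(T)$ with $A$ not connected and $B$ not anticonnected; balanced if there is no path of odd length $>1$ with ends in $B$ and interior in $A$ and no antipath of odd length $>1$ with ends in $A$ and interior in $B$. $\mathcal F$: with $\Sigma(T)$ the graph of switchable pairs, $T\in\mathcal F$ iff $T$ is Berge, each component of $\Sigma(T)$ has at most two edges, and every vertex $v$ of degree two in $\Sigma(T)$ with $\Sigma(T)$-neighbours $x,y$ is either strongly complete to $V(T)\setminus\{v,x,y\}$ with $x,y$ strongly adjacent, or strongly anticomplete to $V(T)\setminus\{v,x,y\}$ with $x,y$ strongly antiadjacent. A $2$-join of $T$ is a partition $(X_1,X_2)$ of $V(T)$ for which there are disjoint sets $A_1,B_1,C_1,A_2,B_2,C_2$ (a split) with $X_i=A_i\cup B_i\cup C_i$, $A_1,A_2,B_1,B_2$ nonempty, no switchable pair meeting both $X_1$ and $X_2$, $A_1$ strongly complete to $A_2$, $B_1$ strongly complete to $B_2$, no other strong edges between $X_1$ and $X_2$, $|X_i|\ge3$, and for $i=1,2$, if $|A_i|=|B_i|=1$ then the full realization of $T|X_i$ is not a path of length two joining the vertex of $A_i$ to the vertex of $B_i$. It is proper if for $i=1,2$ every component of $T|X_i$ meets both $A_i$ and $B_i$. -}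

module Defs where

open import Data.Nat using (ℕ; zero; suc; _≤_; _<_; _∸_)
open import Data.Nat.Properties using ()
open import Data.Fin using (Fin; toℕ) renaming (_<_ to _<ᶠ_)
open import Data.Fin.Subset using (Subset; _∈_; _∉_; _∪_; ∁; ∣_∣; Empty; Nonempty; ⊤)
open import Data.Product using (Σ; ∃; _×_; _,_)
open import Data.Sum using (_⊎_)
open import Data.Empty using (⊥)
open import Relation.Nullary using (¬_)
open import Relation.Binary.PropositionalEquality using (_≡_; _≢_)
open import Function.Definitions using (Injective)

-- Trigraphs on the vertex set Fin n.
-- θ(uv) ∈ {-1,0,1} is encoded as anti / switch / strong.
-- θ is a symmetric function; its value on the diagonal is irrelevant
-- (every notion below only uses θ on pairs of distinct vertices).

data Val : Set where
  strong switch anti : Val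

record Trigraph (n : ℕ) : Set where
  field
    θ    : Fin n → Fin n → Val
    θsym : ∀ u v → θ u v ≡ θ v u
open Trigraph public

module _ {n : ℕ} (T : Trigraph n) where

  StrongAdj : Fin n → Fin n → Set
  StrongAdj u v = u ≢ v × θ T u v ≡ strong

  StrongAnti : Fin n → Fin n → Set
  StrongAnti u v = u ≢ v × θ T u v ≡ anti

  Switch : Fin n → Fin n → Set
  Switch u v = u ≢ v × θ T u v ≡ switch

  Adj : Fin n → Fin n → Set
  Adj u v = u ≢ v × θ T u v ≢ anti

  Anti : Fin n → Fin n → Set
  Anti u v = u ≢ v × θ T u v ≢ strong

data Reach {n : ℕ} (R : Fin n → Fin n → Set) (X : Subset n) : Fin n → Fin n → Set where
  here : ∀ {u} → u ∈ X → Reach R X u u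
  step : ∀ {u w v} → u ∈ X → R u w → Reach R X w v → Reach R X u v

module _ {n : ℕ} (T : Trigraph n) where

  -- X is connected: the full realization of T|X is connected
  Connected : Subset n → Set
  Connected X = ∀ u v → u ∈ X → v ∈ X → Reach (Adj T) X u v

  -- X is anticonnected: the complement of the graph on X of strongly
  -- adjacent pairs is connected (its edges are the antiadjacent pairs)
  Anticonnected : Subset n → Set
  Anticonnected X = ∀ u v → u ∈ X → v ∈ X → Reach (Anti T) X u v

  -- Paths p_0 … p_{k-1} (length k-1), holes, antipaths, antiholes.

  IsPath : (k : ℕ) → (Fin k → Fin n) → Set
  IsPath k p = Injective _≡_ _≡_ p
             × (∀ i j → toℕ j ≡ suc (toℕ i) → Adj T (p i) (p j))
             × (∀ i j → suc (toℕ i) < toℕ j → Anti T (p i) (p j))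

  IsAntipath : (k : ℕ) → (Fin k → Fin n) → Set
  IsAntipath k p = Injective _≡_ _≡_ p
             × (∀ i j → toℕ j ≡ suc (toℕ i) → Anti T (p i) (p j))
             × (∀ i j → suc (toℕ i) < toℕ j → Adj T (p i) (p j))

  -- i,j (i < j) are cyclically consecutive in Fin k
  CycConsec : (k : ℕ) → Fin k → Fin k → Set
  CycConsec k i j = toℕ j ≡ suc (toℕ i) ⊎ (toℕ i ≡ 0 × suc (toℕ j) ≡ k)

  IsHole : (k : ℕ) → (Fin k → Fin n) → Set
  IsHole k h = 4 ≤ k × Injective _≡_ _≡_ h
             × (∀ i j → i <ᶠ j → CycConsec k i j → Adj T (h i) (h j))
             × (∀ i j → i <ᶠ j → ¬ CycConsec k i j → Anti T (h i) (h j))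

  IsAntihole : (k : ℕ) → (Fin k → Fin n) → Set
  IsAntihole k h = 4 ≤ k × Injective _≡_ _≡_ h
             × (∀ i j → i <ᶠ j → CycConsec k i j → Anti T (h i) (h j))
             × (∀ i j → i <ᶠ j → ¬ CycConsec k i j → Adj T (h i) (h j))

  data Odd : ℕ → Set where
    one : Odd 1
    ss  : ∀ {m} → Odd m → Odd (suc (suc m))

  Berge : Set
  Berge = (∀ k h → Odd k → ¬ IsHole k h) × (∀ k h → Odd k → ¬ IsAntihole k h)

  SEdge : Set
  SEdge = Σ (Fin n) λ a → Σ (Fin n) λ b → a <ᶠ b × Switch T a b

  InComp : Fin n → SEdge → Set
  InComp v (a , _) = Reach (Switch T) ⊤ v a

  edgeEnds : SEdge → Fin n × Fin n
  edgeEnds (a , b , _) = a , b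

  SigmaCompsSmall : Set
  SigmaCompsSmall = ¬ (Σ (Fin n) λ v → Σ SEdge λ e₁ → Σ SEdge λ e₂ → Σ SEdge λ e₃ →
      InComp v e₁ × InComp v e₂ × InComp v e₃
    × edgeEnds e₁ ≢ edgeEnds e₂ × edgeEnds e₁ ≢ edgeEnds e₃ × edgeEnds e₂ ≢ edgeEnds e₃)

  SigmaDeg2 : Fin n → Fin n → Fin n → Set
  SigmaDeg2 v x y = x ≢ y × Switch T v x × Switch T v y
                  × (∀ z → Switch T v z → z ≡ x ⊎ z ≡ y)

  Deg2Condition : Set
  Deg2Condition = ∀ v x y → SigmaDeg2 v x y →
      ((∀ w → w ≢ v → w ≢ x → w ≢ y → θ T v w ≡ strong) × θ T x y ≡ strong)
    ⊎ ((∀ w → w ≢ v → w ≢ x → w ≢ y → θ T v w ≡ anti) × θ T x y ≡ anti)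

  InF : Set
  InF = Berge × SigmaCompsSmall × Deg2Condition

  NotConnected : Subset n → Set
  NotConnected X = ¬ Connected X

  NotAnticonnected : Subset n → Set
  NotAnticonnected X = ¬ Anticonnected X

  -- balanced skew-partition (A, B) with B = complement of A:
  -- A not connected, B not anticonnected, no path of odd length > 1
  -- with ends in B and interior in A, no antipath of odd length > 1
  -- with ends in A and interior in B.  (k = number of vertices.)
  BalancedSkewPartition : Subset n → Set
  BalancedSkewPartition A =
      NotConnected A × NotAnticonnected (∁ A)
    × (¬ Σ ℕ λ k → Σ (Fin k → Fin n) λ p → Σ (Odd (k ∸ 1)) λ _ →
         1 < k ∸ 1 × IsPath k p
         × (∀ i → (toℕ i ≡ 0 ⊎ suc (toℕ i) ≡ k) → p i ∈ ∁ A)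
         × (∀ i → 0 < toℕ i → suc (toℕ i) < k → p i ∈ A))
    × (¬ Σ ℕ λ k → Σ (Fin k → Fin n) λ p → Σ (Odd (k ∸ 1)) λ _ →
         1 < k ∸ 1 × IsAntipath k p
         × (∀ i → (toℕ i ≡ 0 ⊎ suc (toℕ i) ≡ k) → p i ∈ A)
         × (∀ i → 0 < toℕ i → suc (toℕ i) < k → p i ∈ ∁ A))

  HasBalancedSkewPartition : Set
  HasBalancedSkewPartition = Σ (Subset n) BalancedSkewPartition

  Disjoint : Subset n → Subset n → Set
  Disjoint P Q = ∀ x → x ∈ P → x ∉ Q

  StronglyComplete : Subset n → Subset n → Set
  StronglyComplete P Q = ∀ u v → u ∈ P → v ∈ Q → θ T u v ≡ strong

  -- the full realization of T|X is a path of length two joining a to b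
  -- (X = {a, c, b}, a–c and c–b adjacent, a and b strongly antiadjacent)
  IsP3 : Subset n → Fin n → Fin n → Set
  IsP3 X a b = Σ (Fin n) λ c → a ≢ b × a ≢ c × b ≢ c
             × (∀ x → x ∈ X → x ≡ a ⊎ x ≡ c ⊎ x ≡ b)
             × a ∈ X × b ∈ X × c ∈ X
             × Adj T a c × Adj T c b × θ T a b ≡ anti

  record IsSplit (X₁ X₂ A₁ B₁ C₁ A₂ B₂ C₂ : Subset n) : Set where
    field
      X₁≡ : X₁ ≡ A₁ ∪ B₁ ∪ C₁
      X₂≡ : X₂ ≡ A₂ ∪ B₂ ∪ C₂
      cover   : ∀ v → v ∈ X₁ ⊎ v ∈ X₂
      X₁X₂    : Disjoint X₁ X₂
      A₁B₁ : Disjoint A₁ B₁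
      A₁C₁ : Disjoint A₁ C₁
      B₁C₁ : Disjoint B₁ C₁
      A₂B₂ : Disjoint A₂ B₂
      A₂C₂ : Disjoint A₂ C₂
      B₂C₂ : Disjoint B₂ C₂
      A₁ne : Nonempty A₁
      B₁ne : Nonempty B₁
      A₂ne : Nonempty A₂
      B₂ne : Nonempty B₂
      noSwitchAcross : ∀ u v → u ∈ X₁ → v ∈ X₂ → θ T u v ≢ switch
      A₁A₂ : StronglyComplete A₁ A₂
      B₁B₂ : StronglyComplete B₁ B₂
      noOtherStrong : ∀ u v → u ∈ X₁ → v ∈ X₂ →
                      ¬ (u ∈ A₁ × v ∈ A₂) → ¬ (u ∈ B₁ × v ∈ B₂) →
                      θ T u v ≢ strong
      size₁ : 3 ≤ ∣ X₁ ∣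
      size₂ : 3 ≤ ∣ X₂ ∣
      notP3₁ : ∀ a b → ∣ A₁ ∣ ≡ 1 → ∣ B₁ ∣ ≡ 1 → a ∈ A₁ → b ∈ B₁ → ¬ IsP3 X₁ a b
      notP3₂ : ∀ a b → ∣ A₂ ∣ ≡ 1 → ∣ B₂ ∣ ≡ 1 → a ∈ A₂ → b ∈ B₂ → ¬ IsP3 X₂ a b

  -- every component of T|X meets both A and B
  -- (the component of v is the set of vertices reachable from v in T|X)
  ComponentsMeet : Subset n → Subset n → Subset n → Set
  ComponentsMeet X A B = ∀ v → v ∈ X →
      (Σ (Fin n) λ a → a ∈ A × Reach (Adj T) X v a)
    × (Σ (Fin n) λ b → b ∈ B × Reach (Adj T) X v b)

  Proper : (X₁ X₂ A₁ B₁ A₂ B₂ : Subset n) → Set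
  Proper X₁ X₂ A₁ B₁ A₂ B₂ = ComponentsMeet X₁ A₁ B₁ × ComponentsMeet X₂ A₂ B₂

  SideProps : (A B C : Subset n) → Set
  SideProps A B C =
      (∀ v → v ∈ A ∪ B ∪ C → Σ (Fin n) λ u → u ∈ A ∪ B ∪ C × Adj T v u)
    × (∀ a → a ∈ A → Σ (Fin n) λ b → b ∈ B × Anti T a b)
    × (∀ b → b ∈ B → Σ (Fin n) λ a → a ∈ A × Anti T b a)
    × (∀ a → a ∈ A → Σ (Fin n) λ u → u ∈ C ∪ B × Adj T a u)
    × (∀ b → b ∈ B → Σ (Fin n) λ u → u ∈ C ∪ A × Adj T b u)
    × (Empty C → 2 ≤ ∣ A ∣ × 2 ≤ ∣ B ∣)
    × 4 ≤ ∣ A ∪ B ∪ C ∣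

{-# OPTIONS --safe #-}
module Submission where

-- Suppose a is isolated in A for some skew-partition (A , B), with neighbourhood N ⊆ B. Shrink
-- B to N, or to N together with one vertex outside N strongly complete to N. Then a is complete
-- to the part of B that matters and anticomplete to A, so it closes an odd path or antipath
-- violating balancedness into an odd hole or antihole. Hence a Berge trigraph without balanced
-- skew-partition has no such skew-partition and, by complementation, no star cutset.
-- Properness and the (anti)neighbour statements follow by exhibiting one of these two.
-- If C₁ = ∅ and A₁ = {a}, these statements make a switchable to all of B₁, against T ∈ 𝓕.
-- If X₁ = {a , b , c}, they leave only a triangle with ab switchable, and an induced path from
-- A₂ to B₂ then gives two holes of consecutive lengths.

open import Defs
open import Data.Bool using (true; false)
open import Data.Empty using (⊥; ⊥-elim)
open import Data.Fin using (Fin; zero; suc; toℕ; inject₁; fromℕ) renaming (_<_ to _<ᶠ_)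
open import Data.Fin.Properties using (_≟_; any?; toℕ-inject₁; toℕ-injective; toℕ-fromℕ; toℕ<n; <-cmp; suc-injective)
open import Data.Fin.Subset using (Subset; _∈_; _∉_; _⊆_; _⊃_; _∪_; ∁; ⁅_⁆; ∣_∣; Empty; Nonempty)
open import Data.Fin.Subset.Induction using (Acc; acc; ⊃-wellFounded)
open import Data.Fin.Subset.Properties using (_∈?_; x∈p∪q⁻; p⊆p∪q; q⊆p∪q; ∪-assoc; ∪-comm; x∈⁅x⁆; x∈⁅y⁆⇒x≡y; ∣⁅x⁆∣≡1; p⊆q⇒∣p∣≤∣q∣; x∈p∧x≢y⇒x∈p-y; x∈p⇒∣p-x∣<∣p∣; x∈∁p⇒x∉p; x∉p⇒x∈∁p; x∉∁p⇒x∈p; x∈p⇒x∉∁p; ∈⊤)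
open import Data.Nat using (ℕ; zero; suc; _+_; _∸_; _≤_; _<_; z≤n; s≤s)
import Data.Nat.Properties as ℕ
open import Data.Product using (Σ; ∃; _×_; _,_; proj₁; proj₂)
open import Data.Sum using (_⊎_; inj₁; inj₂; [_,_]; [_,_]′; swap)
open import Data.Vec using ([]; _∷_; tabulate)
open import Data.Vec.Functional using () renaming (_∷_ to _◂_)
open import Data.Vec.Properties using ([]=⇒lookup; lookup⇒[]=; lookup∘tabulate)
open import Function using (_∘_)
open import Function.Definitions using (Injective)
open import Relation.Binary using (tri<; tri≈; tri>)
open import Relation.Binary.PropositionalEquality using (_≡_; _≢_; refl; sym; trans; cong; subst; ≢-sym)
open import Relation.Nullary using (¬_; Dec; yes; no; does; contradiction)
open import Relation.Nullary.Decidable using (¬?; _×-dec_; _⊎-dec_; dec-true; ¬¬-excluded-middle)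
open import Relation.Unary using (Decidable)

private
  variable
    n k : ℕ

-- Finite subsets

module _ {P : Fin n → Set} (P? : Decidable P) where

  comprehension : Subset n
  comprehension = tabulate (does ∘ P?)

  ∈-comprehension⁺ : ∀ {x} → P x → x ∈ comprehension
  ∈-comprehension⁺ {x} px = lookup⇒[]= x _ (trans (lookup∘tabulate _ x) (dec-true (P? x) px))

  ∈-comprehension⁻ : ∀ {x} → x ∈ comprehension → P x
  ∈-comprehension⁻ {x} x∈ with P? x | trans (sym (lookup∘tabulate (does ∘ P?) x)) ([]=⇒lookup x∈)
  ... | yes px | _ = px

∪-swap : (p q r : Subset n) → p ∪ q ∪ r ≡ q ∪ p ∪ r
∪-swap p q r = trans (sym (∪-assoc p q r)) (trans (cong (_∪ r) (∪-comm p q)) (∪-assoc q p r))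

∣p∪q∣≤∣p∣+∣q∣ : (p q : Subset n) → ∣ p ∪ q ∣ ≤ ∣ p ∣ + ∣ q ∣
∣p∪q∣≤∣p∣+∣q∣ []          []          = z≤n
∣p∪q∣≤∣p∣+∣q∣ (false ∷ p) (false ∷ q) = ∣p∪q∣≤∣p∣+∣q∣ p q
∣p∪q∣≤∣p∣+∣q∣ (true ∷ p)  (false ∷ q) = s≤s (∣p∪q∣≤∣p∣+∣q∣ p q)
∣p∪q∣≤∣p∣+∣q∣ (false ∷ p) (true ∷ q)  =
  ℕ.≤-trans (s≤s (∣p∪q∣≤∣p∣+∣q∣ p q)) (ℕ.≤-reflexive (sym (ℕ.+-suc ∣ p ∣ ∣ q ∣)))
∣p∪q∣≤∣p∣+∣q∣ (true ∷ p)  (true ∷ q)  =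
  s≤s (ℕ.≤-trans (∣p∪q∣≤∣p∣+∣q∣ p q) (ℕ.+-monoʳ-≤ ∣ p ∣ (ℕ.n≤1+n ∣ q ∣)))

∣pair∣≤2 : (x y : Fin n) → ∣ ⁅ x ⁆ ∪ ⁅ y ⁆ ∣ ≤ 2
∣pair∣≤2 x y with ∣p∪q∣≤∣p∣+∣q∣ ⁅ x ⁆ ⁅ y ⁆
... | le rewrite ∣⁅x⁆∣≡1 x | ∣⁅x⁆∣≡1 y = le

-- If every element of `p` were `x` or `y`, then `p` would sit inside a set of at most two elements.
-- The vertices `x` and `y` may coincide.
third-member : {p : Subset n} → 3 ≤ ∣ p ∣ → ∀ x y → ∃ λ z → z ∈ p × z ≢ x × z ≢ y
third-member {p = p} 3≤ x y
  with any? (λ z → (z ∈? p) ×-dec (¬? (z ≟ x) ×-dec ¬? (z ≟ y)))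
... | yes r = r
... | no none = contradiction (ℕ.≤-trans 3≤ (ℕ.≤-trans (p⊆q⇒∣p∣≤∣q∣ p⊆pair) (∣pair∣≤2 x y))) λ { (s≤s (s≤s ())) }
  where
  p⊆pair : p ⊆ ⁅ x ⁆ ∪ ⁅ y ⁆
  p⊆pair {z} z∈p with z ≟ x | z ≟ y
  ... | yes refl | _ = p⊆p∪q _ (x∈⁅x⁆ z)
  ... | no _ | yes refl = q⊆p∪q _ _ (x∈⁅x⁆ z)
  ... | no z≢x | no z≢y = contradiction (z , z∈p , z≢x , z≢y) none

card≥1 : {p : Subset n} → ∀ {x} → x ∈ p → 1 ≤ ∣ p ∣
card≥1 x∈p = ℕ.≤-trans (s≤s z≤n) (x∈p⇒∣p-x∣<∣p∣ x∈p)

card≥2 : {p : Subset n} → ∀ {x y} → x ∈ p → y ∈ p → y ≢ x → 2 ≤ ∣ p ∣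
card≥2 x∈p y∈p y≢x =
  ℕ.≤-trans (s≤s (card≥1 (x∈p∧x≢y⇒x∈p-y y∈p y≢x))) (x∈p⇒∣p-x∣<∣p∣ x∈p)

card≥3 : {p : Subset n} → ∀ {x y z} → x ∈ p → y ∈ p → z ∈ p → y ≢ x → z ≢ x → z ≢ y → 3 ≤ ∣ p ∣
card≥3 x∈p y∈p z∈p y≢x z≢x z≢y =
  ℕ.≤-trans (s≤s (card≥2 (x∈p∧x≢y⇒x∈p-y y∈p y≢x) (x∈p∧x≢y⇒x∈p-y z∈p z≢x) z≢y)) (x∈p⇒∣p-x∣<∣p∣ x∈p)

card≥4 : {p : Subset n} → ∀ {x y z w} → x ∈ p → y ∈ p → z ∈ p → w ∈ p →
  y ≢ x → z ≢ x → z ≢ y → w ≢ x → w ≢ y → w ≢ z → 4 ≤ ∣ p ∣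
card≥4 x∈p y∈p z∈p w∈p y≢x z≢x z≢y w≢x w≢y w≢z =
  ℕ.≤-trans (s≤s (card≥3 (x∈p∧x≢y⇒x∈p-y y∈p y≢x) (x∈p∧x≢y⇒x∈p-y z∈p z≢x) (x∈p∧x≢y⇒x∈p-y w∈p w≢x) z≢y w≢y w≢z))
    (x∈p⇒∣p-x∣<∣p∣ x∈p)

card≡1 : {p : Subset n} → ∀ {x} → x ∈ p → (∀ y → y ∈ p → y ≡ x) → ∣ p ∣ ≡ 1
card≡1 {p = p} {x} x∈p only = ℕ.≤-antisym
  (ℕ.≤-trans (p⊆q⇒∣p∣≤∣q∣ λ {y} y∈p → subst (_∈ ⁅ x ⁆) (sym (only y y∈p)) (x∈⁅x⁆ x)) (ℕ.≤-reflexive (∣⁅x⁆∣≡1 x)))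
  (card≥1 x∈p)

-- Reachability

module _ {R : Fin n → Fin n → Set} where

  reach-source : ∀ {X u v} → Reach R X u v → u ∈ X
  reach-source (here u∈X)     = u∈X
  reach-source (step u∈X _ _) = u∈X

  reach-first : ∀ {X u v} → Reach R X u v → u ≢ v → ∃ λ w → w ∈ X × R u w
  reach-first (here _)     u≢u = contradiction refl u≢u
  reach-first (step _ r p) _   = _ , reach-source p , r

  reach-snoc : ∀ {X u v w} → Reach R X u v → R v w → w ∈ X → Reach R X u w
  reach-snoc (here u∈X)     r w∈X = step u∈X r (here w∈X)
  reach-snoc (step u∈X s p) r w∈X = step u∈X s (reach-snoc p r w∈X)

  reach-map : ∀ {S : Fin n → Fin n → Set} {X Y u v} → (∀ {x y} → R x y → S x y) →
    X ⊆ Y → Reach R X u v → Reach S Y u v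
  reach-map f X⊆Y (here u∈X)     = here (X⊆Y u∈X)
  reach-map f X⊆Y (step u∈X r p) = step (X⊆Y u∈X) (f r) (reach-map f X⊆Y p)

  -- Used to refute connectedness: a property preserved along edges inside `X` cannot hold at one
  -- end of a walk and fail at the other.
  reach-invariant : ∀ {X u v} (U : Fin n → Set) →
    (∀ x y → x ∈ X → y ∈ X → U x → R x y → U y) → Reach R X u v → U u → U v
  reach-invariant U inv (here _)       Uu = Uu
  reach-invariant U inv (step u∈X r p) Uu =
    reach-invariant U inv p (inv _ _ u∈X (reach-source p) Uu r)

  module _ (R? : ∀ u v → Dec (R u v)) where

    -- Saturate {v} until it meets A; a saturated set missing A is excluded by hypothesis.
    reach-set : ∀ {X A v} → v ∈ X →
      (∀ K → v ∈ K → K ⊆ X → (∀ x y → x ∈ K → y ∈ X → y ∉ K → ¬ R x y) → ¬ (∀ x → x ∈ K → x ∉ A)) →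
      ∃ λ a → a ∈ A × Reach R X v a
    reach-set {X} {A} {v} v∈X noClosed =
      saturate ⁅ v ⁆ (⊃-wellFounded _) (x∈⁅x⁆ v)
        (λ x x∈ → subst (Reach R X v) (sym (x∈⁅y⁆⇒x≡y v x∈)) (here v∈X))
      where
      reach-target : ∀ {u w} → Reach R X u w → w ∈ X
      reach-target (here w∈X)   = w∈X
      reach-target (step _ _ p) = reach-target p
      saturate : ∀ K → Acc _⊃_ K → v ∈ K →
        (∀ x → x ∈ K → Reach R X v x) → ∃ λ a → a ∈ A × Reach R X v a
      saturate K (acc rec) v∈K reach
        with any? (λ x → (x ∈? K) ×-dec (x ∈? A))
      ... | yes (x , x∈K , x∈A) = x , x∈A , reach x x∈K
      ... | no misses
        with any? (λ x → any? (λ y → (x ∈? K) ×-dec ((y ∈? X) ×-dec (¬? (y ∈? K) ×-dec R? x y))))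
      ... | no closed = ⊥-elim (noClosed K v∈K (λ x∈K → reach-target (reach _ x∈K))
              (λ x y x∈K y∈X y∉K r → closed (x , y , x∈K , y∈X , y∉K , r))
              (λ x x∈K x∈A → misses (x , x∈K , x∈A)))
      ... | yes (x , y , x∈K , y∈X , y∉K , r) =
        saturate (K ∪ ⁅ y ⁆)
          (rec (p⊆p∪q _ , y , q⊆p∪q _ _ (x∈⁅x⁆ y) , y∉K))
          (p⊆p∪q _ v∈K)
          (λ z z∈ → [ reach z , (λ z∈y → subst (Reach R X v) (sym (x∈⁅y⁆⇒x≡y y z∈y)) (reach-snoc (reach x x∈K) r y∈X)) ]
                      (x∈p∪q⁻ K ⁅ y ⁆ z∈))

-- Adjacency and complementation

_≟ᵛ_ : (s t : Val) → Dec (s ≡ t)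
strong ≟ᵛ strong = yes refl
strong ≟ᵛ switch = no λ ()
strong ≟ᵛ anti   = no λ ()
switch ≟ᵛ strong = no λ ()
switch ≟ᵛ switch = yes refl
switch ≟ᵛ anti   = no λ ()
anti   ≟ᵛ strong = no λ ()
anti   ≟ᵛ switch = no λ ()
anti   ≟ᵛ anti   = yes refl

negate : Val → Val
negate strong = anti
negate switch = switch
negate anti   = strong

negate-involutive : ∀ t → negate (negate t) ≡ t
negate-involutive strong = refl
negate-involutive switch = refl
negate-involutive anti   = refl

-- The complement trigraph, which turns antipaths and antiholes into paths and holes.
co : Trigraph n → Trigraph n
co T = record { θ = λ u v → negate (θ T u v) ; θsym = λ u v → cong negate (θsym T u v) }

negate-≡ : ∀ {s t} → negate s ≡ t → s ≡ negate t
negate-≡ {s} refl = sym (negate-involutive s)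

module _ (T : Trigraph n) where

  adj? : ∀ u v → Dec (Adj T u v)
  adj? u v = ¬? (u ≟ v) ×-dec ¬? (θ T u v ≟ᵛ anti)

  adj-sym : ∀ {u v} → Adj T u v → Adj T v u
  adj-sym {u} {v} (u≢v , t) = ≢-sym u≢v , λ e → t (trans (θsym T u v) e)

  anti-sym : ∀ {u v} → Anti T u v → Anti T v u
  anti-sym {u} {v} (u≢v , t) = ≢-sym u≢v , λ e → t (trans (θsym T u v) e)

  ¬adj⇒anti : ∀ {u v} → u ≢ v → ¬ Adj T u v → θ T u v ≡ anti
  ¬adj⇒anti {u} {v} u≢v ¬adj with θ T u v ≟ᵛ anti
  ... | yes e = e
  ... | no t  = contradiction (u≢v , t) ¬adj

  adj∧anti⇒switch : ∀ {u v} → Adj T u v → Anti T u v → Switch T u v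
  adj∧anti⇒switch {u} {v} (u≢v , t) (_ , t′) with θ T u v
  ... | strong = contradiction refl t′
  ... | switch = u≢v , refl
  ... | anti   = contradiction refl t

  anti⇒coAdj : ∀ {u v} → Anti T u v → Adj (co T) u v
  anti⇒coAdj (u≢v , t) = u≢v , t ∘ negate-≡

  adj⇒coAnti : ∀ {u v} → Adj T u v → Anti (co T) u v
  adj⇒coAnti (u≢v , t) = u≢v , t ∘ negate-≡

  coAdj⇒anti : ∀ {u v} → Adj (co T) u v → Anti T u v
  coAdj⇒anti (u≢v , t) = u≢v , t ∘ cong negate

  coAnti⇒adj : ∀ {u v} → Anti (co T) u v → Adj T u v
  coAnti⇒adj (u≢v , t) = u≢v , t ∘ cong negate

  path⇒coAntipath : ∀ {p} → IsPath T k p → IsAntipath (co T) k p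
  path⇒coAntipath (inj , ad , an) =
    inj , (λ i j e → adj⇒coAnti (ad i j e)) , (λ i j e → anti⇒coAdj (an i j e))

  antipath⇒coPath : ∀ {p} → IsAntipath T k p → IsPath (co T) k p
  antipath⇒coPath (inj , an , ad) =
    inj , (λ i j e → anti⇒coAdj (an i j e)) , (λ i j e → adj⇒coAnti (ad i j e))

  coHole⇒antihole : ∀ {h} → IsHole (co T) k h → IsAntihole T k h
  coHole⇒antihole (4≤ , inj , ad , an) =
    4≤ , inj , (λ i j l c → coAdj⇒anti (ad i j l c)) , (λ i j l c → coAnti⇒adj (an i j l c))

  coAntihole⇒hole : ∀ {h} → IsAntihole (co T) k h → IsHole T k h
  coAntihole⇒hole (4≤ , inj , an , ad) =
    4≤ , inj , (λ i j l c → coAnti⇒adj (an i j l c)) , (λ i j l c → coAdj⇒anti (ad i j l c))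

  coOdd : Odd (co T) k → Odd T k
  coOdd one    = one
  coOdd (ss o) = ss (coOdd o)

  oddCo : Odd T k → Odd (co T) k
  oddCo one    = one
  oddCo (ss o) = ss (oddCo o)

  coBerge : Berge T → Berge (co T)
  coBerge (noHole , noAntihole) =
    (λ k h o hole → noAntihole k h (coOdd o) (coHole⇒antihole hole)) ,
    (λ k h o antihole → noHole k h (coOdd o) (coAntihole⇒hole antihole))

  -- Complementation exchanges the two sides of a skew-partition as well as paths and antipaths, so
  -- the first side in `T` is `∁ A`.
  coBalanced : ∀ {A} → BalancedSkewPartition (co T) A → BalancedSkewPartition T (∁ A)
  coBalanced {A} (notConn , notAnti , noPath , noAntipath) =
    (λ conn → notAnti λ u v u∈ v∈ → reach-map adj⇒coAnti (λ x → x) (conn u v u∈ v∈)) ,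
    (λ anticonn → notConn λ u v u∈ v∈ →
       reach-map anti⇒coAdj ∁∁⊆ (anticonn u v (⊆∁∁ u∈) (⊆∁∁ v∈))) ,
    (λ (k , p , o , l , path , ends , inner) → noAntipath
       (k , p , oddCo o , l , path⇒coAntipath path , (λ i e → ∁∁⊆ (ends i e)) , inner)) ,
    (λ (k , p , o , l , antipath , ends , inner) → noPath
       (k , p , oddCo o , l , antipath⇒coPath antipath , ends , (λ i e f → ∁∁⊆ (inner i e f))))
    where
    ∁∁⊆ : ∁ (∁ A) ⊆ A
    ∁∁⊆ x∈ = x∉∁p⇒x∈p (x∈∁p⇒x∉p x∈)
    ⊆∁∁ : A ⊆ ∁ (∁ A)
    ⊆∁∁ x∈ = x∉p⇒x∈∁p (x∈p⇒x∉∁p x∈)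

-- Paths and holes

◂-injective : ∀ {p : Fin k → Fin n} {u} → Injective _≡_ _≡_ p → (∀ i → u ≢ p i) → Injective _≡_ _≡_ (u ◂ p)
◂-injective inj fresh {zero}  {zero}  e = refl
◂-injective inj fresh {zero}  {suc j} e = contradiction e (fresh j)
◂-injective inj fresh {suc i} {zero}  e = contradiction (sym e) (fresh i)
◂-injective inj fresh {suc i} {suc j} e = cong suc (inj e)

IsEnd : (k : ℕ) → Fin k → Set
IsEnd k i = toℕ i ≡ 0 ⊎ suc (toℕ i) ≡ k

module _ (T : Trigraph n) where

  path-cons : ∀ {p : Fin (suc k) → Fin n} {u} → IsPath T (suc k) p →
    (∀ i → u ≢ p i) → Adj T u (p zero) → (∀ i → Anti T u (p (suc i))) → IsPath T (suc (suc k)) (u ◂ p)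
  path-cons {k} {p} {u} (inj , ad , an) fresh adj antis = ◂-injective inj fresh , adjacent , antiadjacent
    where
    adjacent : ∀ i j → toℕ j ≡ suc (toℕ i) → Adj T ((u ◂ p) i) ((u ◂ p) j)
    adjacent zero    (suc zero) e = adj
    adjacent (suc i) (suc j)    e = ad i j (ℕ.suc-injective e)
    antiadjacent : ∀ i j → suc (toℕ i) < toℕ j → Anti T ((u ◂ p) i) ((u ◂ p) j)
    antiadjacent zero    (suc zero)    (s≤s ())
    antiadjacent zero    (suc (suc j)) l = antis j
    antiadjacent (suc i) (suc j)       (s≤s l) = an i j l

  path-tail : ∀ {p : Fin (suc k) → Fin n} → IsPath T (suc k) p → IsPath T k (p ∘ suc)
  path-tail (inj , ad , an) =
    (λ e → suc-injective (inj e)) ,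
    (λ i j e → ad (suc i) (suc j) (cong suc e)) , (λ i j l → an (suc i) (suc j) (s≤s l))

  -- In the cyclic order `u` takes index zero, so its two cyclic neighbours are precisely the ends
  -- of `p`.
  hole-cons : ∀ {p : Fin k → Fin n} {u} → 3 ≤ k → IsPath T k p → (∀ i → u ≢ p i) →
    (∀ i → IsEnd k i → Adj T u (p i)) → (∀ i → ¬ IsEnd k i → Anti T u (p i)) → IsHole T (suc k) (u ◂ p)
  hole-cons {k} {p} {u} 3≤k (inj , ad , an) fresh ends inner = s≤s 3≤k , ◂-injective inj fresh , adjacent , antiadjacent
    where
    adjacent : ∀ i j → i <ᶠ j → CycConsec T (suc k) i j → Adj T ((u ◂ p) i) ((u ◂ p) j)
    adjacent zero    (suc j) _ (inj₁ e)       = ends j (inj₁ (ℕ.suc-injective e))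
    adjacent zero    (suc j) _ (inj₂ (_ , e)) = ends j (inj₂ (ℕ.suc-injective e))
    adjacent (suc i) (suc j) _ (inj₁ e)       = ad i j (ℕ.suc-injective e)
    antiadjacent : ∀ i j → i <ᶠ j → ¬ CycConsec T (suc k) i j → Anti T ((u ◂ p) i) ((u ◂ p) j)
    antiadjacent zero    (suc j) _ nc =
      inner j [ (λ e → nc (inj₁ (cong suc e))) , (λ e → nc (inj₂ (refl , cong suc e))) ]
    antiadjacent (suc i) (suc j) (s≤s l) nc =
      an i j (ℕ.≤∧≢⇒< l (λ e → nc (inj₁ (cong suc (sym e)))))

-- An inner index above 1 has an inner predecessor; index 1 has the inner successor 2 because there
-- are at least four vertices.
inner-neighbour : ∀ {m} (i : Fin (4 + m)) → 0 < toℕ i → suc (toℕ i) < 4 + m →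
  ∃ λ (j : Fin (4 + m)) → (0 < toℕ j × suc (toℕ j) < 4 + m) × (toℕ j ≡ suc (toℕ i) ⊎ toℕ i ≡ suc (toℕ j))
inner-neighbour (suc zero)    _ _ = suc (suc zero) , (s≤s z≤n , s≤s (s≤s (s≤s (s≤s z≤n)))) , inj₁ refl
inner-neighbour {m} (suc (suc i)) _ l =
  inject₁ (suc i) , (s≤s z≤n , ℕ.<-trans lt l) , inj₂ (cong (2 +_) (sym (toℕ-inject₁ i)))
  where
  lt : suc (toℕ (inject₁ (suc i))) < suc (suc (suc (toℕ i)))
  lt = ℕ.≤-reflexive (cong (3 +_) (toℕ-inject₁ i))

end? : (i : Fin k) → Dec (IsEnd k i)
end? {k} i = (toℕ i ℕ.≟ 0) ⊎-dec (suc (toℕ i) ℕ.≟ k)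

¬end⇒inner : (i : Fin k) → ¬ IsEnd k i → 0 < toℕ i × suc (toℕ i) < k
¬end⇒inner i ¬end = ℕ.n≢0⇒n>0 (¬end ∘ inj₁) , ℕ.≤∧≢⇒< (toℕ<n i) (¬end ∘ inj₂)

last-index : ∀ k → suc (toℕ (fromℕ k)) ≡ suc k
last-index k = cong suc (toℕ-fromℕ k)

end-elim : (Q : Fin (suc k) → Set) → Q zero → Q (fromℕ k) → ∀ i → IsEnd (suc k) i → Q i
end-elim Q q₀ _ zero    (inj₁ _) = q₀
end-elim {k} Q _ qₖ i (inj₂ e) =
  subst Q (toℕ-injective (trans (toℕ-fromℕ k) (sym (ℕ.suc-injective e)))) qₖ

-- Skew-partitions with a singleton component or anticomponent

module _ (T : Trigraph n) (berge : Berge T) where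

  -- The vertex a closes every odd path into an odd hole and every odd antipath into an odd antihole.
  isolated-balanced : ∀ {D : Fin n → Set} (D? : Decidable D) {a w p q : Fin n} (U : Fin n → Set) →
    ¬ D a → (∀ x → Adj T a x → D x) → (∀ x y → D x → D y → Anti T x y → Adj T a x) →
    w ≢ a → ¬ D w →
    D p → D q → U p → ¬ U q → (∀ x y → D x → D y → U x → Anti T x y → U y) →
    HasBalancedSkewPartition T
  isolated-balanced {D} D? {a} {w} {p} {q} U ¬Da N⊆D anti⇒N w≢a ¬Dw Dp Dq Up ¬Uq closed =
    A , notConnected , notAnticonnected , noPath , noAntipath
    where
    -- `D` is the side that must not be anticonnected. Its complement `A` contains `a` and `w`,
    -- while `U` separates `p` from `q` inside `D`.
    A = comprehension (λ x → ¬? (D? x))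
    ¬D⇒A : ∀ {x} → ¬ D x → x ∈ A
    ¬D⇒A = ∈-comprehension⁺ (λ x → ¬? (D? x))
    A⇒¬D : ∀ {x} → x ∈ A → ¬ D x
    A⇒¬D = ∈-comprehension⁻ (λ x → ¬? (D? x))
    D⇒∁A : ∀ {x} → D x → x ∈ ∁ A
    D⇒∁A Dx = x∉p⇒x∈∁p λ x∈A → A⇒¬D x∈A Dx
    ∁A⇒D : ∀ {x} → x ∈ ∁ A → D x
    ∁A⇒D {x} x∈ with D? x
    ... | yes Dx = Dx
    ... | no ¬Dx = contradiction (¬D⇒A ¬Dx) (x∈∁p⇒x∉p x∈)
    ¬adj : ∀ {x} → x ∈ A → ¬ Adj T a x
    ¬adj x∈A adj = A⇒¬D x∈A (N⊆D _ adj)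
    antiA : ∀ {x} → x ∈ A → a ≢ x → Anti T a x
    antiA x∈A a≢x = a≢x , λ e → ¬adj x∈A (a≢x , λ e′ → contradiction (trans (sym e) e′) λ ())
    -- No vertex of `A` is adjacent to `a`, so a walk in `A` from `a` never reaches `w`.
    notConnected : NotConnected T A
    notConnected conn = w≢a (reach-invariant (_≡ a)
      (λ { x y _ y∈A refl adj → contradiction adj (¬adj y∈A) }) (conn a w (¬D⇒A ¬Da) (¬D⇒A ¬Dw)) refl)
    notAnticonnected : NotAnticonnected T (∁ A)
    notAnticonnected conn = ¬Uq (reach-invariant U
      (λ x y x∈ y∈ → closed x y (∁A⇒D x∈) (∁A⇒D y∈)) (conn p q (D⇒∁A Dp) (D⇒∁A Dq)) Up)
    noPath : ¬ Σ ℕ λ k → Σ (Fin k → Fin n) λ p → Σ (Odd T (k ∸ 1)) λ _ →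
      1 < k ∸ 1 × IsPath T k p × (∀ i → IsEnd k i → p i ∈ ∁ A)
      × (∀ i → 0 < toℕ i → suc (toℕ i) < k → p i ∈ A)
    noPath (suc (suc zero) , _ , one , s≤s () , _)
    -- An odd length above one forces at least four vertices. Adding `a` gives a hole whose length
    -- exceeds that of the path by two, hence is odd.
    noPath (suc (suc (suc (suc m))) , p , ss o , _ , path@(_ , ad , an) , ends , inner) =
      proj₁ berge _ _ (ss (ss o)) (hole-cons T (s≤s (s≤s (s≤s z≤n))) path fresh
        (λ i end → end-elim (λ i → Adj T a (p i)) adj₀ adjₖ i end)
        (λ i ¬end → let (l , r) = ¬end⇒inner i ¬end in antiA (inner i l r) (fresh i)))
      where
      -- Both ends lie in `D` and are antiadjacent, so `anti⇒N` makes them neighbours of `a`.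
      antiEnds : Anti T (p zero) (p (fromℕ (3 + m)))
      antiEnds = an zero _ (s≤s (s≤s z≤n))
      D₀ : D (p zero)
      D₀ = ∁A⇒D (ends zero (inj₁ refl))
      Dₖ : D (p (fromℕ (3 + m)))
      Dₖ = ∁A⇒D (ends _ (inj₂ (last-index _)))
      adj₀ = anti⇒N _ _ D₀ Dₖ antiEnds
      adjₖ = anti⇒N _ _ Dₖ D₀ (anti-sym T antiEnds)
      -- The ends lie in `D`, unlike `a`; as an inner vertex, `a` would have a path-neighbour in
      -- `A`.
      fresh : ∀ i → a ≢ p i
      fresh i refl with end? i
      ... | yes end = ¬Da (∁A⇒D (ends i end))
      ... | no ¬end with ¬end⇒inner i ¬end
      ... | l , r with inner-neighbour i l r
      ... | j , (l′ , r′) , inj₁ e = ¬adj (inner j l′ r′) (ad i j e)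
      ... | j , (l′ , r′) , inj₂ e = ¬adj (inner j l′ r′) (adj-sym T (ad j i e))
    noAntipath : ¬ Σ ℕ λ k → Σ (Fin k → Fin n) λ p → Σ (Odd T (k ∸ 1)) λ _ →
      1 < k ∸ 1 × IsAntipath T k p × (∀ i → IsEnd k i → p i ∈ A)
      × (∀ i → 0 < toℕ i → suc (toℕ i) < k → p i ∈ ∁ A)
    noAntipath (suc (suc zero) , _ , one , s≤s () , _)
    noAntipath (suc (suc (suc (suc m))) , p , ss o , _ , antipath@(_ , an , ad) , ends , inner) =
      proj₂ berge _ _ (ss (ss o)) (coHole⇒antihole T (hole-cons (co T) (s≤s (s≤s (s≤s z≤n)))
        (antipath⇒coPath T antipath) fresh
        (λ i end → anti⇒coAdj T (antiA (ends i end) (fresh i)))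
        (λ i ¬end → let (l , r) = ¬end⇒inner i ¬end in adj⇒coAnti T (adjInner i l r))))
      where
      adjEnds : Adj T (p zero) (p (fromℕ (3 + m)))
      adjEnds = ad zero _ (s≤s (s≤s z≤n))
      -- Each inner vertex is antiadjacent to another inner vertex, and both lie in `D`.
      adjInner : ∀ i → 0 < toℕ i → suc (toℕ i) < 4 + m → Adj T a (p i)
      adjInner i l r with inner-neighbour i l r
      ... | j , (l′ , r′) , inj₁ e = anti⇒N _ _ (∁A⇒D (inner i l r)) (∁A⇒D (inner j l′ r′)) (an i j e)
      ... | j , (l′ , r′) , inj₂ e = anti⇒N _ _ (∁A⇒D (inner i l r)) (∁A⇒D (inner j l′ r′)) (anti-sym T (an j i e))
      -- The two ends are adjacent vertices of `A`, so neither can be the isolated `a`.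
      fresh₀ : a ≢ p zero
      fresh₀ refl = ¬adj (ends _ (inj₂ (last-index _))) adjEnds
      freshₖ : a ≢ p (fromℕ (3 + m))
      freshₖ refl = ¬adj (ends zero (inj₁ refl)) (adj-sym T adjEnds)
      fresh : ∀ i → a ≢ p i
      fresh i e with end? i
      ... | yes end = end-elim (λ i → a ≢ p i) fresh₀ freshₖ i end e
      ... | no ¬end = let (l , r) = ¬end⇒inner i ¬end in ¬Da (subst D (sym e) (∁A⇒D (inner i l r)))

  module _ (noBSP : ¬ HasBalancedSkewPartition T) (a : Fin n) where

    private
      -- The side `D` consists of the neighbours of `a` together with `p` and `q`. Since `p` is
      -- strongly complete to the rest of `D`, it is an anticomponent. Every antiadjacent pair of
      -- `D` consists of neighbours of `a`: either `q` is such a neighbour, or `a` has none and `D`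
      -- is just `p` and `q`.
      half : (P Q : Fin n → Set) → (∀ x y → P x → Q y → StrongAdj T x y) → ¬ P a → ¬ Q a →
        (∀ x → Adj T a x → Q x) → ∃ P → (∃ λ q → Q q × (Adj T a q ⊎ (∀ x → ¬ Adj T a x))) →
        (∃ λ w → w ≢ a × ¬ P w × ¬ Q w) → ⊥
      half P Q PQ ¬Pa ¬Qa N⊆Q (p , Pp) (q , Qq , choice) (w , w≢a , ¬Pw , ¬Qw) = noBSP
        (isolated-balanced D? (_≡ p)
          [ (λ (a≢a , _) → a≢a refl) , [ (λ { refl → ¬Pa Pp }) , (λ { refl → ¬Qa Qq }) ] ]
          (λ x → inj₁) anti⇒N w≢a
          [ (λ adj → ¬Qw (N⊆Q w adj)) , [ (λ { refl → ¬Pw Pp }) , (λ { refl → ¬Qw Qq }) ] ]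
          (inj₂ (inj₁ refl)) (inj₂ (inj₂ refl)) refl (λ q≡p → proj₁ (PQ p q Pp Qq) (sym q≡p))
          (λ { x y _ Dy refl an → contradiction an (¬anti-p Dy) }))
        where
        D : Fin n → Set
        D x = Adj T a x ⊎ x ≡ p ⊎ x ≡ q
        D? : Decidable D
        D? x = adj? T a x ⊎-dec ((x ≟ p) ⊎-dec (x ≟ q))
        ¬anti-p : ∀ {y} → D y → ¬ Anti T p y
        ¬anti-p (inj₁ adj)         (_ , t) = t (proj₂ (PQ p _ Pp (N⊆Q _ adj)))
        ¬anti-p (inj₂ (inj₁ refl)) (t , _) = t refl
        ¬anti-p (inj₂ (inj₂ refl)) (_ , t) = t (proj₂ (PQ p q Pp Qq))
        anti⇒N : ∀ x y → D x → D y → Anti T x y → Adj T a x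
        anti⇒N x y (inj₁ adj)         Dy an = adj
        anti⇒N x y (inj₂ (inj₁ refl)) Dy an = contradiction an (¬anti-p Dy)
        anti⇒N x y (inj₂ (inj₂ refl)) (inj₁ adj) an = [ (λ adj′ → adj′) , (λ none → contradiction adj (none y)) ] choice
        anti⇒N x y (inj₂ (inj₂ refl)) (inj₂ (inj₁ refl)) an =
          contradiction (anti-sym T an) (¬anti-p (inj₂ (inj₂ refl)))
        anti⇒N x y (inj₂ (inj₂ refl)) (inj₂ (inj₂ refl)) (t , _) = contradiction refl t

    -- The vertex `a` would be isolated outside `P` and `Q`, with `w` a second vertex there. If its
    -- neighbours meet both `P` and `Q`, they form a suitable side by themselves; otherwise `half`
    -- applies.
    no-isolated-vertex : (P Q : Fin n → Set) → (∀ x y → P x → Q y → StrongAdj T x y) →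
      ¬ P a → ¬ Q a → (∀ x → Adj T a x → P x ⊎ Q x) → ∃ P → ∃ Q →
      (∃ λ w → w ≢ a × ¬ P w × ¬ Q w) → ⊥
    no-isolated-vertex P Q PQ ¬Pa ¬Qa N⊆ (p , Pp) (q , Qq) (w , w≢a , ¬Pw , ¬Qw) =
      -- `P` and `Q` are arbitrary predicates, but the goal is `⊥`, so both questions may be decided
      -- classically.
      ¬¬-excluded-middle λ decP → ¬¬-excluded-middle λ decQ → cases decP decQ
      where
      QP : ∀ x y → Q x → P y → StrongAdj T x y
      QP x y Qx Py = let (x≢y , e) = PQ y x Py Qx in ≢-sym x≢y , trans (θsym T x y) e
      cases : Dec (∃ λ x → Adj T a x × P x) → Dec (∃ λ x → Adj T a x × Q x) → ⊥
      cases (yes (p′ , adjp , Pp′)) (yes (q′ , adjq , Qq′)) = noBSP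
        (isolated-balanced (adj? T a) P (λ (a≢a , _) → a≢a refl) (λ x adj → adj) (λ x y adj _ _ → adj)
          w≢a (λ adj → [ ¬Pw , ¬Qw ] (N⊆ w adj)) adjp adjq Pp′
          (λ Pq′ → proj₁ (PQ q′ q′ Pq′ Qq′) refl)
          (λ x y _ adj Px (_ , t) → [ (λ Py → Py) , (λ Qy → contradiction (proj₂ (PQ x y Px Qy)) t) ] (N⊆ y adj)))
      cases (no noP) (yes (q′ , adjq , Qq′)) = half P Q PQ ¬Pa ¬Qa
        (λ x adj → [ (λ Px → contradiction (x , adj , Px) noP) , (λ Qx → Qx) ] (N⊆ x adj))
        (p , Pp) (q′ , Qq′ , inj₁ adjq) (w , w≢a , ¬Pw , ¬Qw)
      cases (yes (p′ , adjp , Pp′)) (no noQ) = half Q P QP ¬Qa ¬Pa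
        (λ x adj → [ (λ Px → Px) , (λ Qx → contradiction (x , adj , Qx) noQ) ] (N⊆ x adj))
        (q , Qq) (p′ , Pp′ , inj₁ adjp) (w , w≢a , ¬Qw , ¬Pw)
      cases (no noP) (no noQ) = half P Q PQ ¬Pa ¬Qa (λ x adj → contradiction adj (none x))
        (p , Pp) (q , Qq , inj₂ none) (w , w≢a , ¬Pw , ¬Qw)
        where
        none : ∀ x → ¬ Adj T a x
        none x adj = [ (λ Px → noP (x , adj , Px)) , (λ Qx → noQ (x , adj , Qx)) ] (N⊆ x adj)

-- The complement of no-isolated-vertex: the cutset is the complement of P ∪ Q, with centre b.
no-star-cutset : (T : Trigraph n) → Berge T → ¬ HasBalancedSkewPartition T → (b : Fin n) →
  (P Q : Fin n → Set) → (∀ x y → P x → Q y → StrongAnti T x y) →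
  ¬ P b → ¬ Q b → (∀ x → Anti T b x → P x ⊎ Q x) → ∃ P → ∃ Q →
  (∃ λ w → w ≢ b × ¬ P w × ¬ Q w) → ⊥
no-star-cutset T berge noBSP b P Q PQ ¬Pb ¬Qb M⊆ =
  no-isolated-vertex (co T) (coBerge T berge) (λ (A , bal) → noBSP (∁ A , coBalanced T bal)) b P Q
    (λ x y Px Qy → let (x≢y , e) = PQ x y Px Qy in x≢y , cong negate e)
    ¬Pb ¬Qb (λ x adj → M⊆ x (coAdj⇒anti T adj))

-- Induced paths

module _ (T : Trigraph n) (X A : Subset n) (b : Fin n) where

  record PathAvoiding (k : ℕ) (p : Fin (suc k) → Fin n) : Set where
    field
      path   : IsPath T (suc k) p
      last≡b : p (fromℕ k) ≡ b
      inside : ∀ i → p i ∈ X × p i ∉ A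

  -- Since `u` is the only vertex in `A`, a vertex whose neighbours on the path lie in `A` or equal
  -- `b` can see only the ends.
  record PathLeaving : Set where
    field
      len    : ℕ
      u      : Fin n
      q      : Fin (suc len) → Fin n
      u∈A    : u ∈ A
      path   : IsPath T (suc (suc len)) (u ◂ q)
      last≡b : q (fromℕ len) ≡ b
      inside : ∀ i → q i ∈ X × q i ∉ A

  Attachable : Fin n → (k : ℕ) → (Fin (suc k) → Fin n) → Set
  Attachable u k q = (∀ i → u ≢ q i) × Adj T u (q zero) × (∀ i → Anti T u (q (suc i)))

  tail-avoiding : ∀ {p} → PathAvoiding (suc k) p → PathAvoiding k (p ∘ suc)
  tail-avoiding g = record
    { path = path-tail T (PathAvoiding.path g)
    ; last≡b = PathAvoiding.last≡b g
    ; inside = PathAvoiding.inside g ∘ suc }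

  -- Cut the path at the last vertex equal or adjacent to u.
  attach : ∀ k p u → PathAvoiding k p → (∃ λ i → u ≡ p i ⊎ Adj T u (p i)) →
      (∃ λ k′ → ∃ λ q → PathAvoiding k′ q × Attachable u k′ q)
    ⊎ (∃ λ k′ → ∃ λ q → PathAvoiding k′ q × q zero ≡ u)
  attach k p u g touch with u ≟ p zero
  ... | yes e = inj₂ (k , p , g , sym e)
  ... | no u≢p₀ with any? (λ i → (u ≟ p (suc i)) ⊎-dec adj? T u (p (suc i)))
  attach (suc k) p u g touch | no u≢p₀ | yes later = attach k (p ∘ suc) u (tail-avoiding g) later
  ... | no never = inj₁ (k , p , g , fresh , adj touch , antis)
    where
    fresh : ∀ i → u ≢ p i
    fresh zero    = u≢p₀
    fresh (suc i) e = never (i , inj₁ e)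
    adj : (∃ λ i → u ≡ p i ⊎ Adj T u (p i)) → Adj T u (p zero)
    adj (zero  , inj₁ e) = contradiction e u≢p₀
    adj (zero  , inj₂ a) = a
    adj (suc i , e)      = contradiction (i , e) never
    antis : ∀ i → Anti T u (p (suc i))
    antis i = fresh (suc i) , λ e → never (i , inj₂ (fresh (suc i) , λ e′ → contradiction (trans (sym e) e′) λ ()))

  -- Induction along the walk, from `b` backwards: the induced path kept so far starts at the
  -- current vertex and avoids `A`. The first vertex of `A` met in this direction, attached after
  -- shortcuts, gives the leaving path.
  shorten : ∀ {v} → Reach (Adj T) X v b → b ∉ A →
    PathLeaving ⊎ (∃ λ k → ∃ λ q → PathAvoiding k q × q zero ≡ v)
  shorten (here b∈X) b∉A = inj₂ (0 , (λ _ → b) , record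
    { path = (λ { {zero} {zero} _ → refl }) , (λ { zero zero () }) , (λ { zero zero () })
    ; last≡b = refl
    ; inside = λ _ → b∈X , b∉A } , refl)
  shorten {v} (step v∈X adj r) b∉A with shorten r b∉A
  ... | inj₁ found = inj₁ found
  ... | inj₂ (k , q , g , refl) with attach k q v g (zero , inj₂ adj)
  ... | inj₂ through = inj₂ through
  ... | inj₁ (k′ , q′ , g′ , fresh , adj′ , antis) with v ∈? A
  ... | yes v∈A = inj₁ (record
    { u∈A = v∈A ; path = path-cons T (PathAvoiding.path g′) fresh adj′ antis
    ; last≡b = PathAvoiding.last≡b g′ ; inside = PathAvoiding.inside g′ })
  ... | no v∉A = inj₂ (suc k′ , v ◂ q′ , record
    { path = path-cons T (PathAvoiding.path g′) fresh adj′ antis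
    ; last≡b = PathAvoiding.last≡b g′
    ; inside = λ { zero → v∈X , v∉A ; (suc i) → PathAvoiding.inside g′ i } } , refl)

  leaving-path : ∀ {v} → v ∈ A → b ∉ A → Reach (Adj T) X v b → PathLeaving
  leaving-path v∈A b∉A r with shorten r b∉A
  ... | inj₁ found = found
  ... | inj₂ (k , q , g , refl) = contradiction v∈A (proj₂ (PathAvoiding.inside g zero))

odd-or-odd-suc : (T : Trigraph n) → ∀ m → Odd T m ⊎ Odd T (suc m)
odd-or-odd-suc T zero    = inj₂ one
odd-or-odd-suc T (suc m) = [ inj₂ ∘ ss , inj₁ ]′ (odd-or-odd-suc T m)

-- 2-joins

module _ (T : Trigraph n) where

  P3-swap : ∀ {X a b} → IsP3 T X a b → IsP3 T X b a
  P3-swap (c , a≢b , a≢c , b≢c , X⊆ , a∈ , b∈ , c∈ , ac , cb , e) =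
    c , ≢-sym a≢b , b≢c , a≢c ,
    (λ x x∈ → [ inj₂ ∘ inj₂ , [ inj₂ ∘ inj₁ , inj₁ ] ] (X⊆ x x∈)) ,
    b∈ , a∈ , c∈ , adj-sym T cb , adj-sym T ac , trans (θsym T _ _) e

  module _ {X₁ X₂ A₁ B₁ C₁ A₂ B₂ C₂ : Subset n} (s : IsSplit T X₁ X₂ A₁ B₁ C₁ A₂ B₂ C₂) where
    open IsSplit s

    -- With `swap₁₂` this gives the symmetries of a split, which carry statements about `A₁` over to
    -- the other three attachment sets.
    swapAB : IsSplit T X₁ X₂ B₁ A₁ C₁ B₂ A₂ C₂
    swapAB = record
      { X₁≡ = trans X₁≡ (∪-swap A₁ B₁ C₁) ; X₂≡ = trans X₂≡ (∪-swap A₂ B₂ C₂)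
      ; cover = cover ; X₁X₂ = X₁X₂
      ; A₁B₁ = λ x p q → A₁B₁ x q p ; A₁C₁ = B₁C₁ ; B₁C₁ = A₁C₁
      ; A₂B₂ = λ x p q → A₂B₂ x q p ; A₂C₂ = B₂C₂ ; B₂C₂ = A₂C₂
      ; A₁ne = B₁ne ; B₁ne = A₁ne ; A₂ne = B₂ne ; B₂ne = A₂ne
      ; noSwitchAcross = noSwitchAcross
      ; A₁A₂ = B₁B₂ ; B₁B₂ = A₁A₂
      ; noOtherStrong = λ u v u∈ v∈ ¬BB ¬AA → noOtherStrong u v u∈ v∈ ¬AA ¬BB
      ; size₁ = size₁ ; size₂ = size₂
      ; notP3₁ = λ b a |B| |A| b∈ a∈ P3 → notP3₁ a b |A| |B| a∈ b∈ (P3-swap P3)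
      ; notP3₂ = λ b a |B| |A| b∈ a∈ P3 → notP3₂ a b |A| |B| a∈ b∈ (P3-swap P3) }

    swap₁₂ : IsSplit T X₂ X₁ A₂ B₂ C₂ A₁ B₁ C₁
    swap₁₂ = record
      { X₁≡ = X₂≡ ; X₂≡ = X₁≡
      ; cover = swap ∘ cover ; X₁X₂ = λ x p q → X₁X₂ x q p
      ; A₁B₁ = A₂B₂ ; A₁C₁ = A₂C₂ ; B₁C₁ = B₂C₂ ; A₂B₂ = A₁B₁ ; A₂C₂ = A₁C₁ ; B₂C₂ = B₁C₁
      ; A₁ne = A₂ne ; B₁ne = B₂ne ; A₂ne = A₁ne ; B₂ne = B₁ne
      ; noSwitchAcross = λ u v u∈ v∈ e → noSwitchAcross v u v∈ u∈ (trans (θsym T v u) e)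
      ; A₁A₂ = λ u v u∈ v∈ → trans (θsym T u v) (A₁A₂ v u v∈ u∈)
      ; B₁B₂ = λ u v u∈ v∈ → trans (θsym T u v) (B₁B₂ v u v∈ u∈)
      ; noOtherStrong = λ u v u∈ v∈ ¬A ¬B e → noOtherStrong v u v∈ u∈
          (λ (p , q) → ¬A (q , p)) (λ (p , q) → ¬B (q , p)) (trans (θsym T v u) e)
      ; size₁ = size₂ ; size₂ = size₁ ; notP3₁ = notP3₂ ; notP3₂ = notP3₁ }

-- Switchable pairs at one vertex

switch-edge : (T : Trigraph n) → ∀ {a x} → Switch T a x →
  ∃ λ e → InComp T a e × (edgeEnds T e ≡ (a , x) ⊎ edgeEnds T e ≡ (x , a))
switch-edge T {a} {x} sw@(a≢x , t) with <-cmp a x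
-- An `SEdge` lists its ends in increasing order, and membership in a component is tested at the
-- smaller end, which is one step from `a` when it is `x`.
... | tri< a<x _ _ = (a , x , a<x , sw) , here ∈⊤ , inj₁ refl
... | tri≈ _ e _   = contradiction e a≢x
... | tri> _ _ x<a =
  (x , a , x<a , ≢-sym a≢x , trans (θsym T x a) t) , step ∈⊤ sw (here ∈⊤) , inj₂ refl

-- The three edges at `a` lie in one component; whichever order their ends are stored in, distinct
-- far ends make them distinct.
no-three-switches : (T : Trigraph n) → SigmaCompsSmall T → ∀ {a x y z} →
  Switch T a x → Switch T a y → Switch T a z → x ≢ y → x ≢ z → y ≢ z → ⊥
no-three-switches T small {a} sx sy sz x≢y x≢z y≢z
  with switch-edge T sx | switch-edge T sy | switch-edge T sz
... | ex , cx , ix | ey , cy , iy | ez , cz , iz =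
  small (a , ex , ey , ez , cx , cy , cz ,
    distinct sx sy x≢y ix iy , distinct sx sz x≢z ix iz , distinct sy sz y≢z iy iz)
  where
  distinct : ∀ {x y e f} → Switch T a x → Switch T a y → x ≢ y →
    e ≡ (a , x) ⊎ e ≡ (x , a) → f ≡ (a , y) ⊎ f ≡ (y , a) → e ≢ f
  distinct (a≢x , _) (a≢y , _) x≢y (inj₁ refl) (inj₁ refl) refl = x≢y refl
  distinct (a≢x , _) (a≢y , _) x≢y (inj₁ refl) (inj₂ refl) refl = a≢x refl
  distinct (a≢x , _) (a≢y , _) x≢y (inj₂ refl) (inj₁ refl) refl = a≢x refl
  distinct (a≢x , _) (a≢y , _) x≢y (inj₂ refl) (inj₂ refl) refl = x≢y refl

-- Star cutsets and isolated vertices in a 2-join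

module _ (T : Trigraph n) (berge : Berge T) (noBSP : ¬ HasBalancedSkewPartition T) where

  module Split {X₁ X₂ A₁ B₁ C₁ A₂ B₂ C₂ : Subset n} (s : IsSplit T X₁ X₂ A₁ B₁ C₁ A₂ B₂ C₂) where
    open IsSplit s

    A₁⊆X₁ : A₁ ⊆ X₁
    A₁⊆X₁ {x} x∈ = subst (x ∈_) (sym X₁≡) (p⊆p∪q _ x∈)

    B₁⊆X₁ : B₁ ⊆ X₁
    B₁⊆X₁ {x} x∈ = subst (x ∈_) (sym X₁≡) (q⊆p∪q A₁ _ (p⊆p∪q _ x∈))

    C₁⊆X₁ : C₁ ⊆ X₁
    C₁⊆X₁ {x} x∈ = subst (x ∈_) (sym X₁≡) (q⊆p∪q A₁ _ (q⊆p∪q B₁ _ x∈))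

    A₂⊆X₂ : A₂ ⊆ X₂
    A₂⊆X₂ {x} x∈ = subst (x ∈_) (sym X₂≡) (p⊆p∪q _ x∈)

    B₂⊆X₂ : B₂ ⊆ X₂
    B₂⊆X₂ {x} x∈ = subst (x ∈_) (sym X₂≡) (q⊆p∪q A₂ _ (p⊆p∪q _ x∈))

    X₁-cases : ∀ {x} → x ∈ X₁ → x ∈ A₁ ⊎ x ∈ B₁ ⊎ x ∈ C₁
    X₁-cases {x} x∈ with x∈p∪q⁻ A₁ (B₁ ∪ C₁) (subst (x ∈_) X₁≡ x∈)
    ... | inj₁ x∈A = inj₁ x∈A
    ... | inj₂ x∈  = inj₂ (x∈p∪q⁻ B₁ C₁ x∈)

    across≢ : ∀ {x y} → x ∈ X₁ → y ∈ X₂ → x ≢ y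
    across≢ x∈ y∈ refl = X₁X₂ _ x∈ y∈

    across-anti : ∀ {x y} → x ∈ X₁ → y ∈ X₂ → ¬ (x ∈ A₁ × y ∈ A₂) → ¬ (x ∈ B₁ × y ∈ B₂) → StrongAnti T x y
    across-anti {x} {y} x∈ y∈ ¬AA ¬BB
      with θ T x y in e | noSwitchAcross x y x∈ y∈ | noOtherStrong x y x∈ y∈ ¬AA ¬BB
    ... | strong | _ | t = contradiction refl t
    ... | switch | t | _ = contradiction refl t
    ... | anti   | _ | _ = across≢ x∈ y∈ , refl

    module _ {K : Subset n} (K⊆X₁ : K ⊆ X₁)
      (closed : ∀ x y → x ∈ K → y ∈ X₁ → y ∉ K → ¬ Adj T x y) (misses : ∀ x → x ∈ K → x ∉ A₁) where

      -- Edges from `K` leave it neither inside `X₁`, as `K` is closed there, nor towards `A₂`, as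
      -- `K` misses `A₁`; only `B₂` remains.
      closed-set-separated : ∀ {x y} → x ∈ K → y ∉ K → y ∉ B₂ → StrongAnti T x y
      closed-set-separated {x} {y} x∈K y∉K y∉B₂ with cover y
      ... | inj₁ y∈X₁ = let x≢y = λ { refl → y∉K x∈K } in x≢y , ¬adj⇒anti T x≢y (closed x y x∈K y∈X₁ y∉K)
      ... | inj₂ y∈X₂ = across-anti (K⊆X₁ x∈K) y∈X₂ (λ (x∈A , _) → misses x x∈K x∈A) (λ (_ , y∈B) → y∉B₂ y∈B)

      -- {b} ∪ B₂ is a star cutset separating K ∖ {b} from A₂.
      closed-set-within : ∀ {b x} → b ∈ B₁ → x ∈ K → x ≡ b
      closed-set-within {b} {x} b∈B₁ x∈K with x ≟ b
      ... | yes e  = e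
      ... | no x≢b = ⊥-elim (no-star-cutset T berge noBSP b
        (λ x → x ∈ K × x ≢ b) (λ y → y ∉ K × y ≢ b × y ∉ B₂)
        (λ x y (x∈K , _) (y∉K , _ , y∉B₂) → closed-set-separated x∈K y∉K y∉B₂)
        (λ (_ , b≢b) → b≢b refl) (λ (_ , b≢b , _) → b≢b refl) split (x , x∈K , x≢b)
        (let (a₂ , a₂∈) = A₂ne in a₂ , X₂⇒∉K (A₂⊆X₂ a₂∈) , X₂⇒≢b (A₂⊆X₂ a₂∈) , A₂B₂ a₂ a₂∈)
        (let (b₂ , b₂∈) = B₂ne in b₂ , X₂⇒≢b (B₂⊆X₂ b₂∈) , (λ (b₂∈K , _) → X₂⇒∉K (B₂⊆X₂ b₂∈) b₂∈K) , λ (_ , _ , b₂∉) → b₂∉ b₂∈))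
        where
        X₂⇒∉K : ∀ {x} → x ∈ X₂ → x ∉ K
        X₂⇒∉K x∈X₂ x∈K = X₁X₂ _ (K⊆X₁ x∈K) x∈X₂
        X₂⇒≢b : ∀ {x} → x ∈ X₂ → x ≢ b
        X₂⇒≢b x∈X₂ = ≢-sym (across≢ (B₁⊆X₁ b∈B₁) x∈X₂)
        split : ∀ x → Anti T b x → (x ∈ K × x ≢ b) ⊎ (x ∉ K × x ≢ b × x ∉ B₂)
        split x (b≢x , t) with x ∈? K
        ... | yes x∈K = inj₁ (x∈K , ≢-sym b≢x)
        ... | no x∉K  = inj₂ (x∉K , ≢-sym b≢x , λ x∈B₂ → t (B₁B₂ b x b∈B₁ x∈B₂))

      -- By closed-set-within, B₁ = K = {b}; then {a} ∪ A₂ separates X₁ ∖ {a , b} from b.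
      no-closed-set : ∀ {v} → v ∈ K → ⊥
      no-closed-set v∈K = no-star-cutset T berge noBSP a
        (λ x → x ∈ X₁ × x ≢ a × x ≢ b) (λ y → y ≡ b ⊎ (y ∈ X₂ × y ∉ A₂))
        (λ x y (x∈X₁ , x≢a , x≢b) → separated x∈X₁ x≢b)
        (λ (_ , a≢a , _) → a≢a refl)
        [ (λ { refl → A₁B₁ a a∈A₁ b∈B₁ }) , (λ (a∈X₂ , _) → X₁X₂ a (A₁⊆X₁ a∈A₁) a∈X₂) ] split
        (third-member size₁ a b) (b , inj₁ refl)
        (let (a₂ , a₂∈) = A₂ne in a₂ , ≢-sym (across≢ (A₁⊆X₁ a∈A₁) (A₂⊆X₂ a₂∈))
          , (λ (a₂∈X₁ , _) → X₁X₂ a₂ a₂∈X₁ (A₂⊆X₂ a₂∈))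
          , [ ≢-sym (across≢ (B₁⊆X₁ b∈B₁) (A₂⊆X₂ a₂∈)) , (λ (_ , a₂∉) → a₂∉ a₂∈) ])
        where
        a = proj₁ A₁ne
        a∈A₁ = proj₂ A₁ne
        b = proj₁ B₁ne
        b∈B₁ = proj₂ B₁ne
        b∈K : b ∈ K
        b∈K = subst (_∈ K) (closed-set-within b∈B₁ v∈K) v∈K
        separated : ∀ {x y} → x ∈ X₁ → x ≢ b → y ≡ b ⊎ (y ∈ X₂ × y ∉ A₂) → StrongAnti T x y
        separated {x} x∈X₁ x≢b (inj₁ refl) =
          let (_ , e) = closed-set-separated b∈K (λ x∈K → x≢b (closed-set-within b∈B₁ x∈K)) (λ x∈B₂ → X₁X₂ x x∈X₁ (B₂⊆X₂ x∈B₂))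
          in x≢b , trans (θsym T x b) e
        separated {x} x∈X₁ x≢b (inj₂ (y∈X₂ , y∉A₂)) = across-anti x∈X₁ y∈X₂ (λ (_ , y∈A₂) → y∉A₂ y∈A₂)
          (λ (x∈B₁ , _) → x≢b (sym (closed-set-within x∈B₁ b∈K)))
        split : ∀ x → Anti T a x → (x ∈ X₁ × x ≢ a × x ≢ b) ⊎ (x ≡ b ⊎ (x ∈ X₂ × x ∉ A₂))
        split x (a≢x , t) with cover x | x ≟ b
        ... | _         | yes e  = inj₂ (inj₁ e)
        ... | inj₁ x∈X₁ | no x≢b = inj₁ (x∈X₁ , ≢-sym a≢x , x≢b)
        ... | inj₂ x∈X₂ | no _   = inj₂ (inj₂ (x∈X₂ , λ x∈A₂ → t (A₁A₂ a x a∈A₁ x∈A₂)))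

    component-meets-A₁ : ∀ v → v ∈ X₁ → ∃ λ a → a ∈ A₁ × Reach (Adj T) X₁ v a
    component-meets-A₁ v v∈X₁ =
      reach-set (adj? T) v∈X₁ (λ K v∈K K⊆ closed misses → no-closed-set K⊆ closed misses v∈K)

    -- Suppose `a` is strongly complete to `B₁`, as it is to `A₂`. Any other vertex of `X₁` outside
    -- `B₁` is then cut off from `B₂`; without one, the neighbourhood of each vertex of `B₁` splits
    -- into two parts strongly complete to each other.
    antineighbour-in-B₁ : ∀ a → a ∈ A₁ → ∃ λ b → b ∈ B₁ × Anti T a b
    antineighbour-in-B₁ a a∈A₁ with any? (λ b → (b ∈? B₁) ×-dec ¬? (θ T a b ≟ᵛ strong))
    ... | yes (b , b∈B₁ , t) = b , b∈B₁ , (λ { refl → A₁B₁ a a∈A₁ b∈B₁ }) , t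
    ... | no none = ⊥-elim (cases (any? λ x → (x ∈? X₁) ×-dec (¬? (x ≟ a) ×-dec ¬? (x ∈? B₁))))
      where
      complete : ∀ b → b ∈ B₁ → θ T a b ≡ strong
      complete b b∈B₁ with θ T a b ≟ᵛ strong
      ... | yes e = e
      ... | no t  = contradiction (b , b∈B₁ , t) none
      X₂⇒≢a : ∀ {x} → x ∈ X₂ → x ≢ a
      X₂⇒≢a x∈X₂ = ≢-sym (across≢ (A₁⊆X₁ a∈A₁) x∈X₂)
      cases : Dec (∃ λ x → x ∈ X₁ × x ≢ a × x ∉ B₁) → ⊥
      -- {a} ∪ B₁ ∪ A₂ is a star cutset.
      cases (yes other) = no-star-cutset T berge noBSP a
        (λ x → x ∈ X₁ × x ≢ a × x ∉ B₁) (λ y → y ∈ X₂ × y ∉ A₂)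
        (λ x y (x∈X₁ , _ , x∉B₁) (y∈X₂ , y∉A₂) →
          across-anti x∈X₁ y∈X₂ (λ (_ , y∈A₂) → y∉A₂ y∈A₂) (λ (x∈B₁ , _) → x∉B₁ x∈B₁))
        (λ (_ , a≢a , _) → a≢a refl) (λ (a∈X₂ , _) → X₂⇒≢a a∈X₂ refl)
        split other (let (b₂ , b₂∈) = B₂ne in b₂ , B₂⊆X₂ b₂∈ , λ b₂∈A₂ → A₂B₂ b₂ b₂∈A₂ b₂∈)
        (let (a₂ , a₂∈) = A₂ne in a₂ , X₂⇒≢a (A₂⊆X₂ a₂∈) , (λ (a₂∈X₁ , _) → X₁X₂ a₂ a₂∈X₁ (A₂⊆X₂ a₂∈)) , λ (_ , a₂∉) → a₂∉ a₂∈)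
        where
        split : ∀ x → Anti T a x → (x ∈ X₁ × x ≢ a × x ∉ B₁) ⊎ (x ∈ X₂ × x ∉ A₂)
        split x (a≢x , t) with cover x
        ... | inj₁ x∈X₁ = inj₁ (x∈X₁ , ≢-sym a≢x , λ x∈B₁ → t (complete x x∈B₁))
        ... | inj₂ x∈X₂ = inj₂ (x∈X₂ , λ x∈A₂ → t (A₁A₂ a x a∈A₁ x∈A₂))
      -- X₁ = {a} ∪ B₁, so the neighbours of any b ∈ B₁ lie in {a} ∪ B₂ or in B₁ ∖ {b}.
      cases (no X₁⊆) with B₁ne
      ... | b , b∈B₁ with third-member size₁ a b
      ... | b′ , b′∈X₁ , b′≢a , b′≢b = no-isolated-vertex T berge noBSP b
        (λ x → x ≡ a ⊎ x ∈ B₂) (λ y → y ∈ B₁ × y ≢ b)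
        (λ { x y (inj₁ refl) (y∈B₁ , _) → (λ { refl → A₁B₁ a a∈A₁ y∈B₁ }) , complete y y∈B₁
           ; x y (inj₂ x∈B₂) (y∈B₁ , _) → ≢-sym (across≢ (B₁⊆X₁ y∈B₁) (B₂⊆X₂ x∈B₂)) , trans (θsym T x y) (B₁B₂ y x y∈B₁ x∈B₂) })
        [ (λ { refl → A₁B₁ a a∈A₁ b∈B₁ }) , (λ b∈B₂ → X₁X₂ b (B₁⊆X₁ b∈B₁) (B₂⊆X₂ b∈B₂)) ]
        (λ (_ , b≢b) → b≢b refl) split (a , inj₁ refl) (b′ , in-B₁ b′∈X₁ b′≢a , b′≢b)
        (let (a₂ , a₂∈) = A₂ne in a₂ , ≢-sym (across≢ (B₁⊆X₁ b∈B₁) (A₂⊆X₂ a₂∈))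
          , [ X₂⇒≢a (A₂⊆X₂ a₂∈) , A₂B₂ a₂ a₂∈ ] , λ (a₂∈B₁ , _) → X₁X₂ a₂ (B₁⊆X₁ a₂∈B₁) (A₂⊆X₂ a₂∈))
        where
        in-B₁ : ∀ {x} → x ∈ X₁ → x ≢ a → x ∈ B₁
        in-B₁ {x} x∈X₁ x≢a with x ∈? B₁
        ... | yes x∈B₁ = x∈B₁
        ... | no x∉B₁  = contradiction (x , x∈X₁ , x≢a , x∉B₁) X₁⊆
        split : ∀ x → Adj T b x → (x ≡ a ⊎ x ∈ B₂) ⊎ (x ∈ B₁ × x ≢ b)
        split x (b≢x , t) with x ≟ a | cover x
        ... | yes e  | _         = inj₁ (inj₁ e)
        ... | no x≢a | inj₁ x∈X₁ = inj₂ (in-B₁ x∈X₁ x≢a , ≢-sym b≢x)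
        ... | no _   | inj₂ x∈X₂ with x ∈? B₂
        ... | yes x∈B₂ = inj₁ (inj₂ x∈B₂)
        ... | no x∉B₂  = contradiction
          (proj₂ (across-anti (B₁⊆X₁ b∈B₁) x∈X₂ (λ (b∈A₁ , _) → A₁B₁ b b∈A₁ b∈B₁) (λ (_ , x∈B₂) → x∉B₂ x∈B₂))) t

  -- Neighbours inside a side, and sides with three vertices

  module ProperSplit {X₁ X₂ A₁ B₁ C₁ A₂ B₂ C₂ : Subset n} (s : IsSplit T X₁ X₂ A₁ B₁ C₁ A₂ B₂ C₂) where
    open IsSplit s
    open Split s public

    component-meets-B₁ : ∀ v → v ∈ X₁ → ∃ λ b → b ∈ B₁ × Reach (Adj T) X₁ v b
    component-meets-B₁ = Split.component-meets-A₁ (swapAB T s)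

    antineighbour-in-A₁ : ∀ b → b ∈ B₁ → ∃ λ a → a ∈ A₁ × Anti T b a
    antineighbour-in-A₁ = Split.antineighbour-in-B₁ (swapAB T s)

    -- The component of `v` meets both `A₁` and `B₁`, and `v` misses one of them, so a walk to that
    -- set has a first edge.
    neighbour-in-X₁ : ∀ v → v ∈ X₁ → ∃ λ u → u ∈ X₁ × Adj T v u
    neighbour-in-X₁ v v∈X₁ with v ∈? A₁
    ... | yes v∈A₁ = let (b , b∈B₁ , r) = component-meets-B₁ v v∈X₁ in
      reach-first r λ e → A₁B₁ v v∈A₁ (subst (_∈ B₁) (sym e) b∈B₁)
    ... | no v∉A₁ = let (a , a∈A₁ , r) = component-meets-A₁ v v∈X₁ in
      reach-first r λ e → v∉A₁ (subst (_∈ A₁) (sym e) a∈A₁)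

    -- Otherwise all neighbours of `a` lie in `A₁` or `A₂`, which are strongly complete to each
    -- other, and removing them isolates `a` from `B₁`.
    neighbour-of-A₁ : ∀ a → a ∈ A₁ → ∃ λ u → u ∈ C₁ ∪ B₁ × Adj T a u
    neighbour-of-A₁ a a∈A₁ with any? (λ u → (u ∈? (C₁ ∪ B₁)) ×-dec adj? T a u)
    ... | yes r = r
    ... | no none = ⊥-elim (no-isolated-vertex T berge noBSP a
      (λ x → x ∈ A₁ × x ≢ a) (_∈ A₂)
      (λ x y (x∈A₁ , _) y∈A₂ → across≢ (A₁⊆X₁ x∈A₁) (A₂⊆X₂ y∈A₂) , A₁A₂ x y x∈A₁ y∈A₂)
      (λ (_ , a≢a) → a≢a refl) (λ a∈A₂ → X₁X₂ a (A₁⊆X₁ a∈A₁) (A₂⊆X₂ a∈A₂))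
      split
      -- The walk from `a` to `B₁` starts with a neighbour of `a` in `X₁`, which must lie in `A₁`;
      -- this makes the first part nonempty.
      (let (b , b∈B₁ , r) = component-meets-B₁ a (A₁⊆X₁ a∈A₁)
           (a′ , a′∈X₁ , adj) = reach-first r (λ e → A₁B₁ a a∈A₁ (subst (_∈ B₁) (sym e) b∈B₁))
       in a′ , in-A₁ a′∈X₁ adj , ≢-sym (proj₁ adj))
      A₂ne
      (let (b , b∈B₁) = B₁ne in b , (λ { refl → A₁B₁ a a∈A₁ b∈B₁ }) , (λ (b∈A₁ , _) → A₁B₁ b b∈A₁ b∈B₁) , λ b∈A₂ → X₁X₂ b (B₁⊆X₁ b∈B₁) (A₂⊆X₂ b∈A₂)))
      where
      in-A₁ : ∀ {x} → x ∈ X₁ → Adj T a x → x ∈ A₁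
      in-A₁ {x} x∈X₁ adj with X₁-cases x∈X₁
      ... | inj₁ x∈A₁ = x∈A₁
      ... | inj₂ (inj₁ x∈B₁) = contradiction (x , q⊆p∪q C₁ _ x∈B₁ , adj) none
      ... | inj₂ (inj₂ x∈C₁) = contradiction (x , p⊆p∪q _ x∈C₁ , adj) none
      split : ∀ x → Adj T a x → (x ∈ A₁ × x ≢ a) ⊎ x ∈ A₂
      split x adj@(a≢x , t) with cover x | x ∈? A₂
      ... | _         | yes x∈A₂ = inj₂ x∈A₂
      ... | inj₁ x∈X₁ | no _     = inj₁ (in-A₁ x∈X₁ adj , ≢-sym a≢x)
      ... | inj₂ x∈X₂ | no x∉A₂  = contradiction
        (proj₂ (across-anti (A₁⊆X₁ a∈A₁) x∈X₂ (λ (_ , x∈A₂) → x∉A₂ x∈A₂) (λ (a∈B₁ , _) → A₁B₁ a a∈A₁ a∈B₁))) t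

    -- {b} ∪ B₂ would be a star cutset isolating c.
    centre-adjacent : ∀ {a b c} → a ∈ A₁ → b ∈ B₁ → c ∈ C₁ → (∀ x → x ∈ X₁ → x ≡ a ⊎ x ≡ b ⊎ x ≡ c) → Adj T a c
    centre-adjacent {a} {b} {c} a∈A₁ b∈B₁ c∈C₁ X₁⊆ with adj? T a c
    ... | yes adj = adj
    ... | no ¬adj = ⊥-elim (no-star-cutset T berge noBSP b
      (_≡ c) (λ y → y ≢ c × y ≢ b × y ∉ B₂)
      (λ { x y refl (y≢c , y≢b , y∉B₂) → ≢-sym y≢c , separated y≢c y≢b y∉B₂ })
      b≢c (λ (_ , b≢b , _) → b≢b refl) split (c , refl)
      (a , a≢c , (λ { refl → A₁B₁ a a∈A₁ b∈B₁ }) , λ a∈B₂ → X₁X₂ a (A₁⊆X₁ a∈A₁) (B₂⊆X₂ a∈B₂))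
      (let (b₂ , b₂∈) = B₂ne in b₂ , ≢-sym (across≢ (B₁⊆X₁ b∈B₁) (B₂⊆X₂ b₂∈))
        , ≢-sym (across≢ (C₁⊆X₁ c∈C₁) (B₂⊆X₂ b₂∈)) , λ (_ , _ , b₂∉) → b₂∉ b₂∈))
      where
      a≢c : a ≢ c
      a≢c refl = A₁C₁ a a∈A₁ c∈C₁
      b≢c : b ≢ c
      b≢c refl = B₁C₁ b b∈B₁ c∈C₁
      separated : ∀ {y} → y ≢ c → y ≢ b → y ∉ B₂ → θ T c y ≡ anti
      separated {y} y≢c y≢b y∉B₂ with cover y
      ... | inj₂ y∈X₂ = proj₂ (across-anti (C₁⊆X₁ c∈C₁) y∈X₂ (λ (c∈A₁ , _) → A₁C₁ c c∈A₁ c∈C₁) (λ (_ , y∈B₂) → y∉B₂ y∈B₂))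
      ... | inj₁ y∈X₁ with X₁⊆ y y∈X₁
      ... | inj₁ refl = trans (θsym T c a) (¬adj⇒anti T a≢c ¬adj)
      ... | inj₂ (inj₁ y≡b) = contradiction y≡b y≢b
      ... | inj₂ (inj₂ y≡c) = contradiction y≡c y≢c
      split : ∀ x → Anti T b x → x ≡ c ⊎ (x ≢ c × x ≢ b × x ∉ B₂)
      split x (b≢x , t) with x ≟ c
      ... | yes e  = inj₁ e
      ... | no x≢c = inj₂ (x≢c , ≢-sym b≢x , λ x∈B₂ → t (B₁B₂ b x b∈B₁ x∈B₂))

    -- An induced path from A₂ to b through X₂ is closed into a hole by a, and into a hole
    -- one longer by c and a; one of the two is odd.
    no-switch-triangle : ∀ {a b c} → a ∈ A₁ → b ∈ B₁ → c ∈ C₁ → Switch T a b → Adj T a c → Adj T b c →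
      (∀ v → v ∈ X₂ → ∃ λ b₂ → b₂ ∈ B₂ × Reach (Adj T) X₂ v b₂) → ⊥
    no-switch-triangle {a} {b} {c} a∈A₁ b∈B₁ c∈C₁ (a≢b , sw) ac bc meets-B₂ =
      close (leaving-path T (X₂ ∪ ⁅ b ⁆) A₂ b a₂∈A₂ b∉A₂ walk)
      where
      a₂ = proj₁ A₂ne
      a₂∈A₂ = proj₂ A₂ne
      b∉A₂ : b ∉ A₂
      b∉A₂ b∈A₂ = X₁X₂ b (B₁⊆X₁ b∈B₁) (A₂⊆X₂ b∈A₂)
      -- `b` is strongly complete to `B₂`, so a walk inside `X₂` from `a₂` to `B₂` extends to `b`.
      walk : Reach (Adj T) (X₂ ∪ ⁅ b ⁆) a₂ b
      walk = let (b₂ , b₂∈B₂ , r) = meets-B₂ a₂ (A₂⊆X₂ a₂∈A₂) in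
        reach-snoc (reach-map (λ r → r) (p⊆p∪q _) r)
          (≢-sym (across≢ (B₁⊆X₁ b∈B₁) (B₂⊆X₂ b₂∈B₂)) ,
           λ e → contradiction (trans (sym (B₁B₂ b b₂ b∈B₁ b₂∈B₂)) (trans (θsym T b b₂) e)) λ ())
          (q⊆p∪q X₂ _ (x∈⁅x⁆ b))
      strong-anti⇒anti : ∀ {x y} → StrongAnti T x y → Anti T x y
      strong-anti⇒anti (x≢y , e) = x≢y , λ e′ → contradiction (trans (sym e) e′) λ ()
      close : PathLeaving T (X₂ ∪ ⁅ b ⁆) A₂ b → ⊥
      -- A path with two vertices would make `b` adjacent to `u` in `A₂`.
      close record { len = zero ; u = u ; q = q ; u∈A = u∈A₂ ; path = (_ , ad , _) ; last≡b = refl } =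
        proj₂ (ad zero (suc zero) refl)
          (trans (θsym T u (q zero))
            (proj₂ (across-anti (B₁⊆X₁ b∈B₁) (A₂⊆X₂ u∈A₂) (λ (b∈A₁ , _) → A₁B₁ b b∈A₁ b∈B₁) (λ (_ , u∈B₂) → A₂B₂ u u∈A₂ u∈B₂))))
      close record { len = suc k ; u = u ; q = q ; u∈A = u∈A₂ ; path = path ; last≡b = last≡b ; inside = inside } =
        -- The path has `3 + k` vertices, so the two holes have lengths `4 + k` and `5 + k`.
        [ (λ o → proj₁ berge _ _ o short) , (λ o → proj₁ berge _ _ o long) ] (odd-or-odd-suc T (4 + k))
        where
        u∈X₂ = A₂⊆X₂ u∈A₂
        inner : ∀ i → q i ≢ b → q i ∈ X₂
        inner i q≢b = [ (λ q∈ → q∈) , (λ q∈ → contradiction (x∈⁅y⁆⇒x≡y b q∈) q≢b) ] (x∈p∪q⁻ X₂ ⁅ b ⁆ (proj₁ (inside i)))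
        freshX₁ : ∀ {x} → x ∈ X₁ → x ≢ b → ∀ i → x ≢ (u ◂ q) i
        freshX₁ x∈X₁ x≢b zero = across≢ x∈X₁ u∈X₂
        freshX₁ x∈X₁ x≢b (suc i) with q i ≟ b
        ... | yes e  = λ x≡q → x≢b (trans x≡q e)
        ... | no q≢b = across≢ x∈X₁ (inner i q≢b)
        a-anti : ∀ i → q i ≢ b → Anti T a (q i)
        a-anti i q≢b = strong-anti⇒anti (across-anti (A₁⊆X₁ a∈A₁) (inner i q≢b)
          (λ (_ , q∈A₂) → proj₂ (inside i) q∈A₂) (λ (a∈B₁ , _) → A₁B₁ a a∈A₁ a∈B₁))
        c-anti : ∀ {x} → x ∈ X₂ → Anti T c x
        c-anti x∈X₂ = strong-anti⇒anti (across-anti (C₁⊆X₁ c∈C₁) x∈X₂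
          (λ (c∈A₁ , _) → A₁C₁ c c∈A₁ c∈C₁) (λ (c∈B₁ , _) → B₁C₁ c c∈B₁ c∈C₁))
        -- By injectivity the path visits `b` only at its end, so all its other vertices lie in
        -- `X₂`.
        only-last : ∀ i → q i ≡ b → suc (toℕ i) ≡ suc (suc k)
        only-last i e = trans (cong (suc ∘ toℕ) (suc-injective (proj₁ path {suc i} {suc (fromℕ (suc k))} (trans e (sym last≡b)))))
          (last-index (suc k))
        a-adj-u : Adj T a u
        a-adj-u = across≢ (A₁⊆X₁ a∈A₁) u∈X₂ , λ e → contradiction (trans (sym (A₁A₂ a u a∈A₁ u∈A₂)) e) λ ()
        fresh-a = freshX₁ (A₁⊆X₁ a∈A₁) a≢b
        short : IsHole T (4 + k) (a ◂ (u ◂ q))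
        short = hole-cons T (s≤s (s≤s (s≤s z≤n))) path fresh-a
          (end-elim (λ i → Adj T a ((u ◂ q) i)) a-adj-u
            -- The switchable pair of `a` and `b` counts as adjacent here, and as antiadjacent in
            -- `path′`.
            (subst (Adj T a) (sym last≡b) (a≢b , λ e → contradiction (trans (sym sw) e) λ ())))
          (λ { zero ¬end → contradiction (inj₁ refl) ¬end
             ; (suc i) ¬end → a-anti i (λ e → ¬end (inj₂ (cong suc (only-last i e)))) })
        path′ : IsPath T (4 + k) (a ◂ (u ◂ q))
        path′ = path-cons T path fresh-a a-adj-u antis
          where
          antis : ∀ i → Anti T a (q i)
          antis i with q i ≟ b
          ... | yes e  = subst (Anti T a) (sym e) (a≢b , λ e′ → contradiction (trans (sym sw) e′) λ ())
          ... | no q≢b = a-anti i q≢b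
        long : IsHole T (5 + k) (c ◂ (a ◂ (u ◂ q)))
        long = hole-cons T (s≤s (s≤s (s≤s z≤n))) path′
          (λ { zero → ≢-sym (proj₁ ac)
             ; (suc i) → freshX₁ (C₁⊆X₁ c∈C₁) (≢-sym (proj₁ bc)) i })
          (end-elim (λ i → Adj T c ((a ◂ (u ◂ q)) i)) (adj-sym T ac)
            (subst (Adj T c) (sym last≡b) (adj-sym T bc)))
          (λ { zero ¬end → contradiction (inj₁ refl) ¬end
             ; (suc zero) ¬end → c-anti u∈X₂
             ; (suc (suc i)) ¬end → c-anti (inner i λ e → ¬end (inj₂ (cong (2 +_) (only-last i e)))) })

  -- Sizes of the sides

  module _ {X₁ X₂ A₁ B₁ C₁ A₂ B₂ C₂ : Subset n} (s : IsSplit T X₁ X₂ A₁ B₁ C₁ A₂ B₂ C₂)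
    (small : SigmaCompsSmall T) (deg2 : Deg2Condition T) where
    open IsSplit s
    open ProperSplit s

    -- If A₁ = {a} and C₁ is empty, then a is switchable to all of B₁, so it has degree two
    -- in Σ(T); but a is neither complete nor anticomplete to X₂.
    second-member-A₁ : Empty C₁ → ∀ a → a ∈ A₁ → ∃ λ a′ → a′ ∈ A₁ × a′ ≢ a
    second-member-A₁ C₁∅ a a∈A₁ with any? (λ a′ → (a′ ∈? A₁) ×-dec ¬? (a′ ≟ a))
    ... | yes r = r
    -- Repeating `a` asks for a vertex other than `a` alone; a second call gives another one, and
    -- both lie in `B₁`.
    ... | no only with third-member size₁ a a
    ... | x , x∈X₁ , x≢a , _ with third-member size₁ a x
    ... | y , y∈X₁ , y≢a , y≢x = ⊥-elim ([ not-complete , not-anticomplete ] (deg2 a x y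
          (≢-sym y≢x , switchable x∈X₁ x≢a , switchable y∈X₁ y≢a , degree)))
      where
      A₁≡a : ∀ {z} → z ∈ A₁ → z ≡ a
      A₁≡a {z} z∈A₁ with z ≟ a
      ... | yes e  = e
      ... | no z≢a = contradiction (z , z∈A₁ , z≢a) only
      in-B₁ : ∀ {z} → z ∈ X₁ → z ≢ a → z ∈ B₁
      in-B₁ z∈X₁ z≢a with X₁-cases z∈X₁
      ... | inj₁ z∈A₁ = contradiction (A₁≡a z∈A₁) z≢a
      ... | inj₂ (inj₁ z∈B₁) = z∈B₁
      ... | inj₂ (inj₂ z∈C₁) = contradiction (_ , z∈C₁) C₁∅
      -- The neighbour of `b` in `C₁ ∪ A₁` and its antineighbour in `A₁` can only be `a`, so the
      -- pair is switchable.
      adjacent : ∀ {b} → b ∈ B₁ → Adj T a b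
      adjacent {b} b∈B₁ with ProperSplit.neighbour-of-A₁ (swapAB T s) b b∈B₁
      ... | u , u∈ , adj with x∈p∪q⁻ C₁ A₁ u∈
      ... | inj₁ u∈C₁ = contradiction (u , u∈C₁) C₁∅
      ... | inj₂ u∈A₁ rewrite A₁≡a u∈A₁ = adj-sym T adj
      antiadjacent : ∀ {b} → b ∈ B₁ → Anti T a b
      antiadjacent {b} b∈B₁ with antineighbour-in-A₁ b b∈B₁
      ... | u , u∈A₁ , an rewrite A₁≡a u∈A₁ = anti-sym T an
      switchable : ∀ {z} → z ∈ X₁ → z ≢ a → Switch T a z
      switchable z∈X₁ z≢a = adj∧anti⇒switch T (adjacent (in-B₁ z∈X₁ z≢a)) (antiadjacent (in-B₁ z∈X₁ z≢a))
      degree : ∀ z → Switch T a z → z ≡ x ⊎ z ≡ y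
      degree z sw@(a≢z , t) with z ≟ x | z ≟ y
      ... | yes e | _ = inj₁ e
      ... | no _  | yes e = inj₂ e
      ... | no z≢x | no z≢y = ⊥-elim (no-three-switches T small sw (switchable x∈X₁ x≢a) (switchable y∈X₁ y≢a)
        z≢x z≢y (≢-sym y≢x))
      not-complete : ¬ ((∀ w → w ≢ a → w ≢ x → w ≢ y → θ T a w ≡ strong) × θ T x y ≡ strong)
      not-complete (complete , _) with B₂ne
      ... | b₂ , b₂∈ = contradiction
        (trans (sym (complete b₂ (≢-sym (across≢ (A₁⊆X₁ a∈A₁) (B₂⊆X₂ b₂∈))) (≢-sym (across≢ x∈X₁ (B₂⊆X₂ b₂∈))) (≢-sym (across≢ y∈X₁ (B₂⊆X₂ b₂∈)))))
          (proj₂ (across-anti (A₁⊆X₁ a∈A₁) (B₂⊆X₂ b₂∈) (λ (_ , b₂∈A₂) → A₂B₂ b₂ b₂∈A₂ b₂∈) (λ (a∈B₁ , _) → A₁B₁ a a∈A₁ a∈B₁))))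
        λ ()
      not-anticomplete : ¬ ((∀ w → w ≢ a → w ≢ x → w ≢ y → θ T a w ≡ anti) × θ T x y ≡ anti)
      not-anticomplete (anticomplete , _) with A₂ne
      ... | a₂ , a₂∈ = contradiction
        (trans (sym (anticomplete a₂ (≢-sym (across≢ (A₁⊆X₁ a∈A₁) (A₂⊆X₂ a₂∈))) (≢-sym (across≢ x∈X₁ (A₂⊆X₂ a₂∈))) (≢-sym (across≢ y∈X₁ (A₂⊆X₂ a₂∈)))))
          (A₁A₂ a a₂ a∈A₁ a₂∈))
        λ ()

  module _ {X₁ X₂ A₁ B₁ C₁ A₂ B₂ C₂ : Subset n} (s : IsSplit T X₁ X₂ A₁ B₁ C₁ A₂ B₂ C₂)
    (small : SigmaCompsSmall T) (deg2 : Deg2Condition T) where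
    open IsSplit s
    open ProperSplit s

    second-member-B₁ : Empty C₁ → ∀ b → b ∈ B₁ → ∃ λ b′ → b′ ∈ B₁ × b′ ≢ b
    second-member-B₁ = second-member-A₁ (swapAB T s) small deg2

    A₁≢B₁ : ∀ {a b} → a ∈ A₁ → b ∈ B₁ → b ≢ a
    A₁≢B₁ a∈A₁ b∈B₁ refl = A₁B₁ _ a∈A₁ b∈B₁

    two-members : Empty C₁ → 2 ≤ ∣ A₁ ∣ × 2 ≤ ∣ B₁ ∣
    two-members C₁∅ =
      let (a , a∈) = A₁ne
          (b , b∈) = B₁ne
          (a′ , a′∈ , a′≢a) = second-member-A₁ s small deg2 C₁∅ a a∈
          (b′ , b′∈ , b′≢b) = second-member-B₁ C₁∅ b b∈
      in card≥2 a∈ a′∈ a′≢a , card≥2 b∈ b′∈ b′≢b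

    -- Here `A₁` and `B₁` are singletons and `c` is adjacent to both `a` and `b`. The pair `a`, `b`
    -- is not strongly adjacent, since `a` has an antineighbour in `B₁`; not switchable, by the two
    -- holes; and not strongly antiadjacent, since `X₁` would be the path of length two excluded
    -- from a 2-join.
    not-three : ∀ {a b c} → a ∈ A₁ → b ∈ B₁ → c ∈ C₁ → ¬ (∀ x → x ∈ X₁ → x ≡ a ⊎ x ≡ b ⊎ x ≡ c)
    not-three {a} {b} {c} a∈A₁ b∈B₁ c∈C₁ X₁⊆ = by-value (θ T a b) refl
      where
      A₁≡a : ∀ x → x ∈ A₁ → x ≡ a
      A₁≡a x x∈A₁ with X₁⊆ x (A₁⊆X₁ x∈A₁)
      ... | inj₁ x≡a = x≡a
      ... | inj₂ (inj₁ refl) = contradiction b∈B₁ (A₁B₁ x x∈A₁)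
      ... | inj₂ (inj₂ refl) = contradiction c∈C₁ (A₁C₁ x x∈A₁)
      B₁≡b : ∀ x → x ∈ B₁ → x ≡ b
      B₁≡b x x∈B₁ with X₁⊆ x (B₁⊆X₁ x∈B₁)
      ... | inj₁ refl = contradiction x∈B₁ (A₁B₁ x a∈A₁)
      ... | inj₂ (inj₁ x≡b) = x≡b
      ... | inj₂ (inj₂ refl) = contradiction c∈C₁ (B₁C₁ x x∈B₁)
      a≢b : a ≢ b
      a≢b = ≢-sym (A₁≢B₁ a∈A₁ b∈B₁)
      ac : Adj T a c
      ac = centre-adjacent a∈A₁ b∈B₁ c∈C₁ X₁⊆
      bc : Adj T b c
      bc = ProperSplit.centre-adjacent (swapAB T s) b∈B₁ a∈A₁ c∈C₁
        (λ x x∈ → [ inj₂ ∘ inj₁ , [ inj₁ , inj₂ ∘ inj₂ ] ] (X₁⊆ x x∈))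
      by-value : ∀ t → θ T a b ≡ t → ⊥
      by-value strong e =
        let (b′ , b′∈B₁ , _ , t) = antineighbour-in-B₁ a a∈A₁
        in t (subst (λ x → θ T a x ≡ strong) (sym (B₁≡b b′ b′∈B₁)) e)
      by-value switch e = no-switch-triangle a∈A₁ b∈B₁ c∈C₁ (a≢b , e) ac bc
        (ProperSplit.component-meets-B₁ (swap₁₂ T s))
      by-value anti e = notP3₁ a b (card≡1 a∈A₁ A₁≡a) (card≡1 b∈B₁ B₁≡b) a∈A₁ b∈B₁
        (c , a≢b , proj₁ ac , proj₁ bc ,
         (λ x x∈ → [ inj₁ , [ inj₂ ∘ inj₂ , inj₂ ∘ inj₁ ] ] (X₁⊆ x x∈)) ,
         A₁⊆X₁ a∈A₁ , B₁⊆X₁ b∈B₁ , C₁⊆X₁ c∈C₁ , ac , adj-sym T bc , e)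

    -- An empty `C₁` forces two vertices in each of `A₁` and `B₁`; otherwise one vertex from each of
    -- the three sets cannot exhaust `X₁`, by `not-three`.
    four-members : 4 ≤ ∣ X₁ ∣
    four-members = let (a , a∈) = A₁ne ; (b , b∈) = B₁ne in by-C₁ a∈ b∈ (any? (_∈? C₁))
      where
      by-C₁ : ∀ {a b} → a ∈ A₁ → b ∈ B₁ → Dec (Nonempty C₁) → 4 ≤ ∣ X₁ ∣
      by-C₁ {a} {b} a∈ b∈ (no C₁∅) =
        let (a′ , a′∈ , a′≢a) = second-member-A₁ s small deg2 C₁∅ a a∈
            (b′ , b′∈ , b′≢b) = second-member-B₁ C₁∅ b b∈
        in card≥4 (A₁⊆X₁ a∈) (A₁⊆X₁ a′∈) (B₁⊆X₁ b∈) (B₁⊆X₁ b′∈)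
             a′≢a (A₁≢B₁ a∈ b∈) (A₁≢B₁ a′∈ b∈) (A₁≢B₁ a∈ b′∈) (A₁≢B₁ a′∈ b′∈) b′≢b
      by-C₁ {a} {b} a∈ b∈ (yes (c , c∈))
        with any? (λ d → (d ∈? X₁) ×-dec (¬? (d ≟ a) ×-dec (¬? (d ≟ b) ×-dec ¬? (d ≟ c))))
      ... | yes (d , d∈ , d≢a , d≢b , d≢c) = card≥4 (A₁⊆X₁ a∈) (B₁⊆X₁ b∈) (C₁⊆X₁ c∈) d∈
        (A₁≢B₁ a∈ b∈) (λ { refl → A₁C₁ c a∈ c∈ }) (λ { refl → B₁C₁ c b∈ c∈ }) d≢a d≢b d≢c
      ... | no none = ⊥-elim (not-three a∈ b∈ c∈ only)
        where
        only : ∀ x → x ∈ X₁ → x ≡ a ⊎ x ≡ b ⊎ x ≡ c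
        only x x∈ with x ≟ a | x ≟ b | x ≟ c
        ... | yes e | _     | _     = inj₁ e
        ... | no _  | yes e | _     = inj₂ (inj₁ e)
        ... | no _  | no _  | yes e = inj₂ (inj₂ e)
        ... | no p  | no q  | no r  = contradiction (x , x∈ , p , q , r) none

    side-properties : SideProps T A₁ B₁ C₁
    side-properties =
      (λ v v∈ → let (u , u∈ , adj) = neighbour-in-X₁ v (subst (v ∈_) (sym X₁≡) v∈) in u , subst (u ∈_) X₁≡ u∈ , adj) ,
      antineighbour-in-B₁ , antineighbour-in-A₁ , neighbour-of-A₁ , ProperSplit.neighbour-of-A₁ (swapAB T s) ,
      two-members , subst (λ X → 4 ≤ ∣ X ∣) X₁≡ four-members

theorem3p1 : (n : ℕ) (T : Trigraph n) → InF T → ¬ HasBalancedSkewPartition T →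
    (X₁ X₂ A₁ B₁ C₁ A₂ B₂ C₂ : Subset n) → IsSplit T X₁ X₂ A₁ B₁ C₁ A₂ B₂ C₂ →
    Proper T X₁ X₂ A₁ B₁ A₂ B₂ × SideProps T A₁ B₁ C₁ × SideProps T A₂ B₂ C₂
theorem3p1 n T (berge , small , deg2) noBSP _ _ _ _ _ _ _ _ s =
  ((λ v v∈ → S₁.component-meets-A₁ v v∈ , S₁.component-meets-B₁ v v∈) ,
   (λ v v∈ → S₂.component-meets-A₁ v v∈ , S₂.component-meets-B₁ v v∈)) ,
  side-properties T berge noBSP s small deg2 ,
  side-properties T berge noBSP (swap₁₂ T s) small deg2
  where
  module S₁ = ProperSplit T berge noBSP s
  module S₂ = ProperSplit T berge noBSP (swap₁₂ T s)
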